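{- For $n=2,3,4$ we have $f(n)=2n-3$, and for every $n\geq 5$ we have $f(n)=2n-2$.
   Context: A box is an axis-aligned rectangle with a fixed width and height. A representation of a set of boxes places each box (by translation) in the plane so that the interiors of the boxes are pairwise disjoint; two boxes touch if they have a common boundary (a common boundary segment of positive length). For a set $\mathcal{B}$ of boxes, $f(\mathcal{B})$ denotes the maximum, over all representations of $\mathcal{B}$, of the number of unordered pairs of boxes that touch. For a positive integer $n$, $f(n)=\min\{f(\mathcal{B}) : |\mathcal{B}|=n\}$, the minimum over all sets of $n$ boxes with arbitrary dimensions. -}

module Defs where

open import Algebra.Bundles using (CommutativeRing)
open import Data.Fin as Fin using (Fin)
import Data.Fin.Properties as Fin
open import Data.List using (List; []; _∷_; length; filter; allFin; cartesianProduct)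
open import Data.List.Relation.Unary.Any using (Any; any?)
open import Data.Nat as ℕ using (ℕ)
import Data.Nat.Properties as ℕ
open import Data.Product using (_×_; _,_; ∃; ∃-syntax)
open import Data.Sum using (inj₂)
open import Function.Bundles using (_⇔_; mk⇔)
open import Level using (Level; suc; _⊔_)
open import Relation.Binary using (Rel; IsStrictTotalOrder; Decidable; tri<; tri≈; tri>)
import Relation.Binary.Construct.StrictToNonStrict as ToNonStrict
open import Relation.Binary.PropositionalEquality using (_≡_; _≢_; refl)
open import Relation.Nullary using (¬_; Dec; yes; no)
open import Relation.Nullary.Decidable using (_×-dec_)
open import Relation.Unary using (Pred)

-- The library has no real numbers, so ℝ enters through its axioms: a
-- Dedekind-complete ordered field.  The order is trichotomous, as it is for
-- the classical reals.
record RealNumbers (c ℓ₁ ℓ₂ : Level) : Set (suc (c ⊔ ℓ₁ ⊔ ℓ₂)) where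
  infix 4 _<_
  field
    commutativeRing : CommutativeRing c ℓ₁

  open CommutativeRing commutativeRing public
    using (Carrier; _≈_; _+_; _*_; -_; _-_; 0#; 1#)
  module Ring = CommutativeRing commutativeRing

  field
    _<_                : Rel Carrier ℓ₂
    isStrictTotalOrder : IsStrictTotalOrder _≈_ _<_
    0≉1                : ¬ 0# ≈ 1#
    inverse            : ∀ x → ¬ x ≈ 0# → ∃[ y ] x * y ≈ 1#
    +-monoˡ-<          : ∀ {x y} z → x < y → x + z < y + z
    *-pos              : ∀ {x y} → 0# < x → 0# < y → 0# < x * y

  module Order = IsStrictTotalOrder isStrictTotalOrder

  open ToNonStrict _≈_ _<_ public using (_≤_)

  IsUpperBound : Pred Carrier (c ⊔ ℓ₁ ⊔ ℓ₂) → Carrier → Set (c ⊔ ℓ₁ ⊔ ℓ₂)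
  IsUpperBound P b = ∀ x → P x → x ≤ b

  field
    complete : ∀ (P : Pred Carrier (c ⊔ ℓ₁ ⊔ ℓ₂)) → ∃ P → ∃ (IsUpperBound P) →
               ∃[ s ] IsUpperBound P s × (∀ b → IsUpperBound P b → s ≤ b)

module Boxes {c ℓ₁ ℓ₂} (ℝ : RealNumbers c ℓ₁ ℓ₂) where

  open RealNumbers ℝ

  record Box : Set (c ⊔ ℓ₂) where
    field
      width height : Carrier
      0<width      : 0# < width
      0<height     : 0# < height

  record PlacedBox : Set (c ⊔ ℓ₂) where
    field
      box : Box
      x y : Carrier   -- lower left corner
    open Box box public

  Interior : PlacedBox → Carrier → Carrier → Set ℓ₂
  Interior b p q = (x < p × p < x + width) × (y < q × q < y + height)
    where open PlacedBox b

  data Segment : Set c where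
    -- vertical a s t = {a} × [s , t] and horizontal a s t = [s , t] × {a}
    vertical horizontal : (a s t : Carrier) → Segment

  sides : PlacedBox → List Segment
  sides b = vertical   x            y (y + height)
          ∷ vertical   (x + width)  y (y + height)
          ∷ horizontal y            x (x + width)
          ∷ horizontal (y + height) x (x + width)
          ∷ []
    where open PlacedBox b

  data ShareSegment : Segment → Segment → Set (c ⊔ ℓ₁ ⊔ ℓ₂) where
    -- [u , v] is a subinterval of positive length of both [s , t] and [s′ , t′]
    vertical : ∀ {a s t a′ s′ t′} → a ≈ a′ →
      (∃[ u ] ∃[ v ] u < v × (s ≤ u × v ≤ t) × (s′ ≤ u × v ≤ t′)) →
      ShareSegment (vertical a s t) (vertical a′ s′ t′)
    horizontal : ∀ {a s t a′ s′ t′} → a ≈ a′ →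
      (∃[ u ] ∃[ v ] u < v × (s ≤ u × v ≤ t) × (s′ ≤ u × v ≤ t′)) →
      ShareSegment (horizontal a s t) (horizontal a′ s′ t′)

  Touch : Rel PlacedBox (c ⊔ ℓ₁ ⊔ ℓ₂)
  Touch b b′ = Any (λ σ → Any (ShareSegment σ) (sides b′)) (sides b)

  private
    ≤-refl : ∀ {a} → a ≤ a
    ≤-refl = inj₂ Ring.refl

    <⇒≤ : ∀ {a b} → a < b → a ≤ b
    <⇒≤ = ToNonStrict.<⇒≤ _≈_ _<_

    max : ∀ a b → ∃[ m ] a ≤ m × b ≤ m × (∀ {u} → a ≤ u → b ≤ u → m ≤ u)
    max a b with Order.compare a b
    ... | tri< a<b _ _ = b , <⇒≤ a<b , ≤-refl , λ _ b≤u → b≤u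
    ... | tri≈ _ a≈b _ = b , inj₂ a≈b , ≤-refl , λ _ b≤u → b≤u
    ... | tri> _ _ b<a = a , ≤-refl , <⇒≤ b<a , λ a≤u _ → a≤u

    min : ∀ a b → ∃[ m ] m ≤ a × m ≤ b × (∀ {u} → u ≤ a → u ≤ b → u ≤ m)
    min a b with Order.compare a b
    ... | tri< a<b _ _ = a , ≤-refl , <⇒≤ a<b , λ u≤a _ → u≤a
    ... | tri≈ _ a≈b _ = a , ≤-refl , inj₂ a≈b , λ u≤a _ → u≤a
    ... | tri> _ _ b<a = b , <⇒≤ b<a , ≤-refl , λ _ u≤b → u≤b

    overlap? : ∀ s t s′ t′ →
      Dec (∃[ u ] ∃[ v ] u < v × (s ≤ u × v ≤ t) × (s′ ≤ u × v ≤ t′))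
    overlap? s t s′ t′ with max s s′ | min t t′
    ... | m , s≤m , s′≤m , least | k , k≤t , k≤t′ , greatest with m Order.<? k
    ...   | yes m<k = yes (m , k , m<k , (s≤m , k≤t) , (s′≤m , k≤t′))
    ...   | no m≮k  = no λ where
      (u , v , u<v , (s≤u , v≤t) , (s′≤u , v≤t′)) →
        m≮k (ToNonStrict.<-≤-trans _≈_ _<_ Order.trans Order.<-respʳ-≈
              (ToNonStrict.≤-<-trans _≈_ _<_ Ring.sym Order.trans Order.<-respˡ-≈
                (least s≤u s′≤u) u<v)
              (greatest v≤t v≤t′))

  shareSegment? : Decidable ShareSegment
  shareSegment? (vertical a s t) (vertical a′ s′ t′)
    with a Order.≟ a′ | overlap? s t s′ t′
  ... | yes p | yes q = yes (vertical p q)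
  ... | no ¬p | _     = no λ { (vertical p _) → ¬p p }
  ... | _     | no ¬q = no λ { (vertical _ q) → ¬q q }
  shareSegment? (horizontal a s t) (horizontal a′ s′ t′)
    with a Order.≟ a′ | overlap? s t s′ t′
  ... | yes p | yes q = yes (horizontal p q)
  ... | no ¬p | _     = no λ { (horizontal p _) → ¬p p }
  ... | _     | no ¬q = no λ { (horizontal _ q) → ¬q q }
  shareSegment? (vertical _ _ _) (horizontal _ _ _) = no λ ()
  shareSegment? (horizontal _ _ _) (vertical _ _ _) = no λ ()

  touch? : Decidable Touch
  touch? b b′ = any? (λ σ → any? (shareSegment? σ) (sides b′)) (sides b)

  -- A box is determined by its dimensions (placement is not part of it), so a
  -- set of n boxes has n different pairs of dimensions.  Repetitions matter:
  -- five unit squares never have more than 7 contacts, while any five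
  -- different boxes can be placed with 8.
  record BoxSet (n : ℕ) : Set (c ⊔ ℓ₁ ⊔ ℓ₂) where
    field
      box      : Fin n → Box
      distinct : ∀ {i j} → i ≢ j →
                 ¬ (Box.width (box i) ≈ Box.width (box j) ×
                    Box.height (box i) ≈ Box.height (box j))

  record Representation {n : ℕ} (B : BoxSet n) : Set (c ⊔ ℓ₂) where
    field
      x y : Fin n → Carrier

    placed : Fin n → PlacedBox
    placed i = record { box = BoxSet.box B i ; x = x i ; y = y i }

    field
      disjoint : ∀ {i j} → i ≢ j → ∀ p q →
                 ¬ (Interior (placed i) p q × Interior (placed j) p q)

  contacts : ∀ {n} {B : BoxSet n} → Representation B → ℕ
  contacts {n} R =
    length (filter (λ (i , j) → (i Fin.<? j) ×-dec touch? (placed i) (placed j))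
                   (cartesianProduct (allFin n) (allFin n)))
    where open Representation R

  -- f(B) = k
  MaxContacts : ∀ {n} → BoxSet n → ℕ → Set (c ⊔ ℓ₂)
  MaxContacts B k = (∃[ R ] contacts {B = B} R ≡ k) ×
                    (∀ (R : Representation B) → contacts R ℕ.≤ k)

  -- m ≤ f(B): a maximum is at least m iff some element is.  In this form the
  -- bound applies to every B, also when no k with f(B) = k has been exhibited.
  _≤MaxContacts_ : ∀ {n} → ℕ → BoxSet n → Set (c ⊔ ℓ₂)
  m ≤MaxContacts B = ∃[ R ] m ℕ.≤ contacts {B = B} R

  ≤MaxContacts⇔≤ : ∀ {n} {B : BoxSet n} {k m} → MaxContacts B k →
                   m ≤MaxContacts B ⇔ m ℕ.≤ k
  ≤MaxContacts⇔≤ ((R , refl) , max-R) =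
    mk⇔ (λ (R′ , m≤) → ℕ.≤-trans m≤ (max-R R′)) (λ m≤k → R , m≤k)

  -- f(n) = m
  MinMaxContacts : ℕ → ℕ → Set (c ⊔ ℓ₁ ⊔ ℓ₂)
  MinMaxContacts n m = (∃[ B ] MaxContacts {n} B m) ×
                       (∀ (B : BoxSet n) → m ≤MaxContacts B)

{-# OPTIONS --safe #-}
-- Upper bound.  Take squares of sides 1, 3, 9, ….  A contact between vertical
-- sides is charged to the one of the two sides with the lower top; a side is
-- charged at most once, and the highest side on each vertical line is not
-- charged.  The boxes, seen as edges between the lines of their two vertical
-- sides, form a forest, because the lengths 3^k cannot cancel along a cycle;
-- so there are at least n + 1 lines, and at most 2n - (n + 1) contacts between
-- vertical sides.  The same holds for horizontal sides.  Four boxes cannot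
-- touch pairwise: they would have a common point and occupy the four quadrants
-- around it, one each.
--
-- Lower bound.  Grow two rows of boxes along a horizontal line, always
-- lengthening the shorter one: the new box touches the last box of each row.
-- If the rows end at the same place, a box straddling the line there touches
-- both, and its top edge becomes the new line.  Starting from two boxes this
-- gives 2n - 3 contacts.  Starting from one box surrounded by four others,
-- which has 8 contacts, it gives 2n - 2.  For the center of these five boxes
-- take the narrowest of the three least tall ones.
module Submission where

open import Defs
open import Algebra.Properties.CommutativeSemigroup using (x∙yz≈y∙xz)
import Algebra.Properties.Group
import Algebra.Properties.Ring
open import Data.Bool using (Bool; true; false)
import Data.Bool.Properties as Bool
open import Data.Empty using (⊥; ⊥-elim)
open import Data.Fin as Fin using (Fin; zero; suc; toℕ; fromℕ<)
import Data.Fin.Properties as Fin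
open import Data.List using (List; []; _∷_; _++_; length; map; filter; tabulate; allFin; cartesianProduct)
open import Data.List.Membership.Propositional using (_∈_; lose)
open import Data.List.Membership.Propositional.Properties using (∈-∃++; ∈-++⁻; ∈-++⁺ˡ; ∈-++⁺ʳ; ∈-map⁺; ∈-allFin; ∈-filter⁺; ∈-filter⁻; ∈-cartesianProduct⁺)
open import Data.List.Properties using (length-++; length-map; length-tabulate; length-filter; filter-++; filter-≐; filter-accept; filter-notAll; map-tabulate; ∷-injective)
open import Data.List.Relation.Binary.Permutation.Propositional as ↭ using (_↭_; ↭-refl; ↭-sym; ↭-trans; ↭-prep; ↭-swap; ↭-reflexive)
open import Data.List.Relation.Binary.Permutation.Propositional.Properties using (↭-map-inv; ↭-length; filter-↭; map⁺; ++⁺ˡ; ++-comm; shift; All-resp-↭; ∈-resp-↭)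
open import Data.List.Relation.Unary.All as All using (All; []; _∷_)
import Data.List.Relation.Unary.All.Properties as All
open import Data.List.Relation.Unary.AllPairs using (AllPairs; []; _∷_)
import Data.List.Relation.Unary.AllPairs.Properties as AllPairs
open import Data.List.Relation.Unary.Any as Any using (here; there)
import Data.List.Relation.Unary.Any.Properties as Any
open import Data.List.Relation.Unary.Unique.Propositional using (Unique)
import Data.List.Relation.Unary.Unique.Propositional.Properties as Unique
open import Data.Nat as ℕ using (ℕ; zero; suc)
import Data.Nat.Properties as ℕ
open import Data.Product as Product using (_×_; _,_; proj₁; proj₂; ∃; ∃₂; ∃-syntax)
import Data.Product.Properties as Product
open import Data.Sum as Sum using (_⊎_; inj₁; inj₂; [_,_])
import Data.Sum.Properties as Sum
open import Function using (_∘_; id)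
open import Level using (Level; _⊔_)
open import Relation.Binary using (Rel; Symmetric; Transitive; Total; Trans; Decidable; DecidableEquality; tri<; tri≈; tri>)
open import Relation.Binary.Bundles using (StrictTotalOrder)
import Relation.Binary.Construct.StrictToNonStrict as ToNonStrict
open import Relation.Binary.PropositionalEquality as ≡ using (_≡_; _≢_; refl; cong; cong₂)
import Relation.Binary.Reasoning.StrictPartialOrder
open import Relation.Nullary using (¬_; Dec; yes; no; contradiction; ¬?)
open import Relation.Nullary.Decidable using (_×-dec_; _⊎-dec_)
open import Relation.Unary as Unary using (Pred)

-- Counting in lists: injections, filters, permutations and unordered pairs.

module Counting where

  open import Data.Nat using (_+_; _≤_; _<_; z≤n; s≤s)

  private
    variable
      a b p q r : Level
      A : Set a
      B : Set b

  -- Induction on `xs`: `f x` is cut out of `ys`, and injectivity keeps the images of the remaining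
  -- elements inside what is left.
  injection-length : (f : A → B) {xs : List A} {ys : List B} → Unique xs →
    (∀ {x} → x ∈ xs → f x ∈ ys) →
    (∀ {x y} → x ∈ xs → y ∈ xs → f x ≡ f y → x ≡ y) →
    length xs ≤ length ys
  injection-length f {[]} _ _ _ = z≤n
  injection-length f {x ∷ xs} (x∉ ∷ uniq) into inj with ∈-∃++ (into (here refl))
  ... | us , vs , refl = begin
      suc (length xs)         ≤⟨ s≤s (injection-length f uniq into′ (λ u v → inj (there u) (there v))) ⟩
      suc (length (us ++ vs)) ≡⟨ cong suc (length-++ us) ⟩
      suc (length us + length vs) ≡⟨ ℕ.+-suc (length us) (length vs) ⟨
      length us + suc (length vs) ≡⟨ length-++ us ⟨
      length (us ++ f x ∷ vs) ∎
    where
    open ℕ.≤-Reasoning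
    into′ : ∀ {z} → z ∈ xs → f z ∈ us ++ vs
    into′ z∈ with ∈-++⁻ us (into (there z∈))
    ... | inj₁ ∈us         = ∈-++⁺ˡ ∈us
    ... | inj₂ (there ∈vs) = ∈-++⁺ʳ us ∈vs
    ... | inj₂ (here eq)   =
      contradiction (inj (here refl) (there z∈) (≡.sym eq)) (All.lookup x∉ z∈)

  -- Pigeonhole principle: a missed `x` could be filtered out of `xs`, and the `n` different images
  -- would then have to fit into fewer than `n` places.
  injective⇒surjective : ∀ {n} (f : Fin n → A) → (∀ {i j} → f i ≡ f j → i ≡ j) → DecidableEquality A →
    (xs : List A) → length xs ≤ n → (∀ x → x ∈ xs) → ∀ x → ∃[ i ] f i ≡ x
  injective⇒surjective {n = n} f inj _≟_ xs len all x with Fin.any? (λ i → f i ≟ x)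
  ... | yes hit = hit
  ... | no miss = contradiction
      (ℕ.<-≤-trans (filter-notAll ≢x? xs (lose (all x) (λ ≢x → ≢x refl))) len)
      (ℕ.≤⇒≯ (ℕ.≤-trans (ℕ.≤-reflexive (≡.sym (length-tabulate {n = n} id)))
        (injection-length f (Unique.allFin⁺ n)
          (λ {i} _ → ∈-filter⁺ ≢x? (all (f i)) (λ eq → miss (i , eq)))
          (λ _ _ → inj))))
    where
    ≢x? : Unary.Decidable (_≢ x)
    ≢x? y = ¬? (y ≟ x)

  length-filter-∪ : {P : Pred A p} {Q : Pred A q} {R : Pred A r}
    (P? : Unary.Decidable P) (Q? : Unary.Decidable Q) (R? : Unary.Decidable R) →
    (∀ {x} → P x → Q x ⊎ R x) → ∀ xs →
    length (filter P? xs) ≤ length (filter Q? xs) + length (filter R? xs)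
  length-filter-∪ P? Q? R? split [] = z≤n
  length-filter-∪ P? Q? R? split (x ∷ xs)
    with length-filter-∪ P? Q? R? split xs | P? x | Q? x | R? x
  ... | ih | no _  | no _  | no _   = ih
  ... | ih | no _  | no _  | yes _  = ℕ.≤-trans ih (ℕ.+-monoʳ-≤ (length (filter Q? xs)) (ℕ.n≤1+n _))
  ... | ih | no _  | yes _ | no _   = ℕ.m≤n⇒m≤1+n ih
  ... | ih | no _  | yes _ | yes _  =
    ℕ.m≤n⇒m≤1+n (ℕ.≤-trans ih (ℕ.+-monoʳ-≤ (length (filter Q? xs)) (ℕ.n≤1+n _)))
  ... | ih | yes p | no _  | yes _  rewrite ℕ.+-suc (length (filter Q? xs)) (length (filter R? xs)) = s≤s ih
  ... | ih | yes p | yes _ | no _   = s≤s ih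
  ... | ih | yes p | yes _ | yes _  = s≤s (ℕ.≤-trans ih (ℕ.+-monoʳ-≤ (length (filter Q? xs)) (ℕ.n≤1+n _)))
  ... | ih | yes p | no ¬q | no ¬r with split p
  ...   | inj₁ q = contradiction q ¬q
  ...   | inj₂ r = contradiction r ¬r

  module _ {R : Rel A r} (R-sym : Symmetric R) where

    AllPairs-lookup : ∀ {xs x y} → AllPairs R xs → x ∈ xs → y ∈ xs → x ≢ y → R x y
    AllPairs-lookup (_ ∷ _)   (here refl) (here refl) x≢y = contradiction refl x≢y
    AllPairs-lookup (px ∷ _)  (here refl) (there y∈)  _   = All.lookup px y∈
    AllPairs-lookup (px ∷ _)  (there x∈)  (here refl) _   = R-sym (All.lookup px x∈)
    AllPairs-lookup (_ ∷ pxs) (there x∈)  (there y∈)  x≢y = AllPairs-lookup pxs x∈ y∈ x≢y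

    AllPairs-tabulate⁻ : ∀ {n} {f : Fin n → A} → AllPairs R (tabulate f) →
                         ∀ {i j} → i ≢ j → R (f i) (f j)
    AllPairs-tabulate⁻ (_ ∷ _)   {zero}  {zero}  i≢j = contradiction refl i≢j
    AllPairs-tabulate⁻ (px ∷ _)  {zero}  {suc j} _   = All.tabulate⁻ px j
    AllPairs-tabulate⁻ (px ∷ _)  {suc i} {zero}  _   = R-sym (All.tabulate⁻ px i)
    AllPairs-tabulate⁻ (_ ∷ pxs) {suc i} {suc j} i≢j = AllPairs-tabulate⁻ pxs (i≢j ∘ cong suc)

    AllPairs-resp-↭ : ∀ {xs ys} → xs ↭ ys → AllPairs R xs → AllPairs R ys
    AllPairs-resp-↭ ↭.refl         pxs        = pxs
    AllPairs-resp-↭ (↭.prep x ρ)   (px ∷ pxs) = All-resp-↭ ρ px ∷ AllPairs-resp-↭ ρ pxs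
    AllPairs-resp-↭ (↭.swap x y ρ) ((xy ∷ px) ∷ py ∷ pxs) =
      (R-sym xy ∷ All-resp-↭ ρ py) ∷ All-resp-↭ ρ px ∷ AllPairs-resp-↭ ρ pxs
    AllPairs-resp-↭ (↭.trans ρ σ)  pxs        = AllPairs-resp-↭ σ (AllPairs-resp-↭ ρ pxs)

  module _ {_≼_ : Rel A r} (≼-trans : Transitive _≼_) (≼-total : Total _≼_) where

    selectMin : ∀ x xs → ∃₂ λ m ys → (x ∷ xs ↭ m ∷ ys) × All (m ≼_) ys
    selectMin x []       = x , [] , ↭-refl , []
    selectMin x (y ∷ xs) with selectMin y xs
    ... | m , ys , ρ , m≼ with ≼-total x m
    ...   | inj₁ x≼m = x , m ∷ ys , ↭-prep x ρ , x≼m ∷ All.map (≼-trans x≼m) m≼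
    ...   | inj₂ m≼x = m , x ∷ ys , ↭-trans (↭-prep x ρ) (↭-swap x m ↭-refl) , m≼x ∷ m≼

  count : {P : Pred A p} → Unary.Decidable P → List A → ℕ
  count P? xs = length (filter P? xs)

  count-≐ : {P : Pred A p} {Q : Pred A q} (P? : Unary.Decidable P) (Q? : Unary.Decidable Q) →
            P Unary.≐ Q → ∀ xs → count P? xs ≡ count Q? xs
  count-≐ P? Q? P≐Q xs = cong length (filter-≐ P? Q? P≐Q xs)

  count-++ : {P : Pred A p} (P? : Unary.Decidable P) (xs ys : List A) →
             count P? (xs ++ ys) ≡ count P? xs + count P? ys
  count-++ P? xs ys = ≡.trans (cong length (filter-++ P? xs ys)) (length-++ (filter P? xs))

  count-map : {P : Pred B p} (P? : Unary.Decidable P) (f : A → B) (xs : List A) →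
              count P? (map f xs) ≡ count (P? ∘ f) xs
  count-map P? f []       = refl
  count-map P? f (x ∷ xs) with P? (f x)
  ... | yes _ = cong suc (count-map P? f xs)
  ... | no _  = count-map P? f xs

  count-accept : {P : Pred A p} (P? : Unary.Decidable P) → ∀ {z zs n} →
                 P z → n ≤ count P? zs → suc n ≤ count P? (z ∷ zs)
  count-accept P? {z} {zs} pz n≤ rewrite filter-accept P? {z} {zs} pz = s≤s n≤

  count-skip : {P : Pred A p} (P? : Unary.Decidable P) → ∀ {z zs n} →
               n ≤ count P? zs → n ≤ count P? (z ∷ zs)
  count-skip P? {z} n≤ with P? z
  ... | yes _ = ℕ.m≤n⇒m≤1+n n≤
  ... | no _  = n≤

  count-∁ : {P : Pred A p} (P? : Unary.Decidable P) → ∀ xs →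
            count P? xs + count (¬? ∘ P?) xs ≡ length xs
  count-∁ P? []       = refl
  count-∁ P? (x ∷ xs) with P? x
  ... | yes _ = cong suc (count-∁ P? xs)
  ... | no _  = ≡.trans (ℕ.+-suc (count P? xs) _) (cong suc (count-∁ P? xs))

  count-cartesianProduct-∷ : {P : Pred (A × B) p} (P? : Unary.Decidable P)
    (x : A) (xs : List A) (ys : List B) →
    count P? (cartesianProduct (x ∷ xs) ys) ≡ count (P? ∘ (x ,_)) ys + count P? (cartesianProduct xs ys)
  count-cartesianProduct-∷ P? x xs ys =
    ≡.trans (count-++ P? (map (x ,_) ys) _) (cong (_+ _) (count-map P? (x ,_) ys))

  choose₂ : ℕ → ℕ
  choose₂ zero    = 0
  choose₂ (suc n) = n + choose₂ n

  module Pairs {A : Set a} {R : Rel A r} (R? : Decidable R) where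

    pairs : List A → ℕ
    pairs []       = 0
    pairs (x ∷ xs) = count (R? x) xs + pairs xs

    pairs-≤ : ∀ xs → pairs xs ≤ choose₂ (length xs)
    pairs-≤ []       = z≤n
    pairs-≤ (x ∷ xs) = ℕ.+-mono-≤ (length-filter (R? x) xs) (pairs-≤ xs)

    pairs-< : ∀ xs → ¬ AllPairs R xs → pairs xs < choose₂ (length xs)
    pairs-< []       ¬all = contradiction [] ¬all
    pairs-< (x ∷ xs) ¬all with All.all? (R? x) xs
    ... | yes px = ℕ.+-mono-≤-< (length-filter (R? x) xs) (pairs-< xs (λ pxs → ¬all (px ∷ pxs)))
    ... | no ¬px = ℕ.+-mono-<-≤ (filter-notAll (R? x) xs (All.¬All⇒Any¬ (R? x) xs ¬px)) (pairs-≤ xs)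

    pairs-↭ : Symmetric R → ∀ {xs ys} → xs ↭ ys → pairs xs ≡ pairs ys
    pairs-↭ R-sym ↭.refl = refl
    pairs-↭ R-sym (↭.prep x ρ) = cong₂ _+_ (↭-length (filter-↭ (R? x) ρ)) (pairs-↭ R-sym ρ)
    pairs-↭ R-sym (↭.trans ρ σ) = ≡.trans (pairs-↭ R-sym ρ) (pairs-↭ R-sym σ)
    pairs-↭ R-sym (↭.swap {xs} {ys} x y ρ)
      with R? x y | R? y x | ↭-length (filter-↭ (R? x) ρ) | ↭-length (filter-↭ (R? y) ρ) | pairs-↭ R-sym ρ
    ... | yes _  | yes _  | eqx | eqy | eq rewrite eqx | eqy | eq =
      cong suc (x∙yz≈y∙xz ℕ.+-commutativeSemigroup (count (R? x) ys) (count (R? y) ys) (pairs ys))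
    ... | no _   | no _   | eqx | eqy | eq rewrite eqx | eqy | eq =
      x∙yz≈y∙xz ℕ.+-commutativeSemigroup (count (R? x) ys) (count (R? y) ys) (pairs ys)
    ... | yes xy | no ¬yx | _   | _   | _  = contradiction (R-sym xy) ¬yx
    ... | no ¬xy | yes yx | _   | _   | _  = contradiction (R-sym yx) ¬xy

    -- Links the count over index pairs `i < j` in a grid, the form used by `contacts`, to the
    -- recursive `pairs`, which follows a list as boxes are added one by one.
    count-< : ∀ {n} (f : Fin n → A) →
      count (λ (i , j) → (i Fin.<? j) ×-dec R? (f i) (f j)) (cartesianProduct (allFin n) (allFin n))
        ≡ pairs (tabulate f)
    count-< {zero}  f = refl
    count-< {suc n} f = begin
      count P? (cartesianProduct (allFin (suc n)) (allFin (suc n)))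
        ≡⟨ count-cartesianProduct-∷ P? zero (tabulate suc) (allFin (suc n)) ⟩
      count (P? ∘ (zero ,_)) (allFin (suc n)) + count P? (cartesianProduct (tabulate suc) (allFin (suc n)))
        ≡⟨ cong₂ _+_ row rest ⟩
      count (R? (f zero)) (tabulate (f ∘ suc)) + pairs (tabulate (f ∘ suc)) ∎
      where
      open ≡.≡-Reasoning
      P? : Unary.Decidable (λ (i , j) → i Fin.< j × R (f i) (f j))
      P? (i , j) = (i Fin.<? j) ×-dec R? (f i) (f j)

      tabulate-suc : ∀ {b} {B : Set b} (g : Fin (suc n) → B) → tabulate (g ∘ suc) ≡ map (g ∘ suc) (allFin n)
      tabulate-suc g = ≡.sym (map-tabulate id (g ∘ suc))

      row : count (P? ∘ (zero ,_)) (allFin (suc n)) ≡ count (R? (f zero)) (tabulate (f ∘ suc))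
      row = begin
        count (P? ∘ (zero ,_)) (tabulate suc)
          ≡⟨ cong (count (P? ∘ (zero ,_))) (tabulate-suc id) ⟩
        count (P? ∘ (zero ,_)) (map suc (allFin n))
          ≡⟨ count-map (P? ∘ (zero ,_)) suc (allFin n) ⟩
        count (λ j → P? (zero , suc j)) (allFin n)
          ≡⟨ count-≐ _ (R? (f zero) ∘ f ∘ suc) (proj₂ , (ℕ.z<s ,_)) (allFin n) ⟩
        count (R? (f zero) ∘ f ∘ suc) (allFin n)
          ≡⟨ count-map (R? (f zero)) (f ∘ suc) (allFin n) ⟨
        count (R? (f zero)) (map (f ∘ suc) (allFin n))
          ≡⟨ cong (count (R? (f zero))) (tabulate-suc f) ⟨
        count (R? (f zero)) (tabulate (f ∘ suc)) ∎

      Q? : Unary.Decidable (λ (i , j) → i Fin.< j × R (f (suc i)) (f (suc j)))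
      Q? (i , j) = (i Fin.<? j) ×-dec R? (f (suc i)) (f (suc j))

      -- The first column contributes nothing: `suc i < zero` is refuted by computation, so only the
      -- columns `map suc js` remain.
      rows : ∀ is js → count P? (cartesianProduct (map suc is) (zero ∷ map suc js))
                         ≡ count Q? (cartesianProduct is js)
      rows []       js = refl
      rows (i ∷ is) js = begin
        count P? (cartesianProduct (suc i ∷ map suc is) (zero ∷ map suc js))
          ≡⟨ count-cartesianProduct-∷ P? (suc i) (map suc is) _ ⟩
        count (P? ∘ (suc i ,_)) (zero ∷ map suc js) + count P? (cartesianProduct (map suc is) (zero ∷ map suc js))
          ≡⟨ cong₂ _+_ (count-map (P? ∘ (suc i ,_)) suc js) (rows is js) ⟩
        count (λ j → P? (suc i , suc j)) js + count Q? (cartesianProduct is js)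
          ≡⟨ cong (_+ count Q? (cartesianProduct is js))
               (count-≐ _ (Q? ∘ (i ,_)) ((λ (lt , r) → ℕ.s≤s⁻¹ lt , r) , (λ (lt , r) → s≤s lt , r)) js) ⟩
        count (Q? ∘ (i ,_)) js + count Q? (cartesianProduct is js)
          ≡⟨ count-cartesianProduct-∷ Q? i is js ⟨
        count Q? (cartesianProduct (i ∷ is) js) ∎

      rest : count P? (cartesianProduct (tabulate suc) (allFin (suc n))) ≡ pairs (tabulate (f ∘ suc))
      rest = begin
        count P? (cartesianProduct (tabulate suc) (zero ∷ tabulate suc))
          ≡⟨ cong (λ is → count P? (cartesianProduct is (zero ∷ is))) (tabulate-suc id) ⟩
        count P? (cartesianProduct (map suc (allFin n)) (zero ∷ map suc (allFin n)))
          ≡⟨ rows (allFin n) (allFin n) ⟩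
        count Q? (cartesianProduct (allFin n) (allFin n))
          ≡⟨ count-< (f ∘ suc) ⟩
        pairs (tabulate (f ∘ suc)) ∎

    pairs-two : ∀ {x y z xs} → R x y → R x z → 2 + pairs (y ∷ z ∷ xs) ≤ pairs (x ∷ y ∷ z ∷ xs)
    pairs-two {x} {y} {z} {xs} xy xz =
      ℕ.+-monoˡ-≤ (pairs (y ∷ z ∷ xs)) (count-accept (R? x) xy (count-accept (R? x) {zs = xs} xz z≤n))

    -- The graph is a wheel with hub `f` and rim `a`, `g`, `c`, `e` in cyclic order. Of the ten
    -- pairs only the two opposite rim pairs, `a` with `c` and `g` with `e`, are missing.
    pairs-wheel : ∀ {a g f e c} → R a g → R a f → R a e → R g f → R g c → R f e → R f c → R e c →
                  8 ≤ pairs (a ∷ g ∷ f ∷ e ∷ c ∷ [])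
    pairs-wheel {a} {g} {f} {e} {c} ag af ae gf gc fe fc ec =
      ℕ.+-mono-≤ {3} {_} {5} (accept ag (accept af (accept ae z≤n)))
        (ℕ.+-mono-≤ {2} {_} {3} (accept gf (count-skip (R? g) {e} (accept gc z≤n)))
          (ℕ.+-mono-≤ {2} {_} {1} (accept fe (accept fc z≤n))
            (ℕ.+-mono-≤ {1} {_} {0} (accept ec z≤n) z≤n)))
      where
      accept : ∀ {x y ys n} → R x y → n ≤ count (R? x) ys → suc n ≤ count (R? x) (y ∷ ys)
      accept {x} = count-accept (R? x)

open Counting

-- Order, halving and density in an ordered field.

module OrderedField {c ℓ₁ ℓ₂} (ℝ : RealNumbers c ℓ₁ ℓ₂) where

  open RealNumbers ℝ
  private module NonStrict = ToNonStrict _≈_ _<_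
  open Algebra.Properties.Ring Ring.ring using (-1*x≈-x)

  strictTotalOrder : StrictTotalOrder c ℓ₁ ℓ₂
  strictTotalOrder = record { isStrictTotalOrder = isStrictTotalOrder }

  module Reasoning = Relation.Binary.Reasoning.StrictPartialOrder
    (StrictTotalOrder.strictPartialOrder strictTotalOrder)

  <-irrefl : ∀ {x} → ¬ x < x
  <-irrefl = Order.irrefl Ring.refl

  ≤-refl : ∀ {x} → x ≤ x
  ≤-refl = inj₂ Ring.refl

  <⇒≤ : ∀ {x y} → x < y → x ≤ y
  <⇒≤ = inj₁

  ≤-trans : Transitive _≤_
  ≤-trans = NonStrict.trans Ring.isEquivalence Order.<-resp-≈ Order.trans

  <-≤-trans : Trans _<_ _≤_ _<_
  <-≤-trans = NonStrict.<-≤-trans Order.trans Order.<-respʳ-≈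

  ≤-<-trans : Trans _≤_ _<_ _<_
  ≤-<-trans = NonStrict.≤-<-trans Ring.sym Order.trans Order.<-respˡ-≈

  ≈-<-trans : Trans _≈_ _<_ _<_
  ≈-<-trans x≈y = Order.<-respˡ-≈ (Ring.sym x≈y)

  <-≈-trans : Trans _<_ _≈_ _<_
  <-≈-trans x<y y≈z = Order.<-respʳ-≈ y≈z x<y

  ≤-total : Total _≤_
  ≤-total = NonStrict.total Order.compare

  ≮⇒≥ : ∀ {x y} → ¬ x < y → y ≤ x
  ≮⇒≥ {x} {y} x≮y with Order.compare x y
  ... | tri< x<y _ _ = contradiction x<y x≮y
  ... | tri≈ _ x≈y _ = inj₂ (Ring.sym x≈y)
  ... | tri> _ _ y<x = inj₁ y<x

  ≤⇒≯ : ∀ {x y} → x ≤ y → ¬ y < x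
  ≤⇒≯ x≤y y<x = <-irrefl (≤-<-trans x≤y y<x)

  ≰⇒> : ∀ {x y} → ¬ x ≤ y → y < x
  ≰⇒> {x} {y} x≰y with y Order.<? x
  ... | yes y<x = y<x
  ... | no y≮x  = contradiction (≮⇒≥ y≮x) x≰y

  _≤?_ : Decidable _≤_
  _≤?_ = NonStrict.decidable Order._≟_ Order._<?_

  +-monoʳ-< : ∀ z {x y} → x < y → z + x < z + y
  +-monoʳ-< z x<y = Order.<-respʳ-≈ (Ring.+-comm _ z) (Order.<-respˡ-≈ (Ring.+-comm _ z) (+-monoˡ-< z x<y))

  +-monoˡ-≤ : ∀ z {x y} → x ≤ y → x + z ≤ y + z
  +-monoˡ-≤ z (inj₁ x<y) = inj₁ (+-monoˡ-< z x<y)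
  +-monoˡ-≤ z (inj₂ x≈y) = inj₂ (Ring.+-congʳ x≈y)

  +-monoʳ-≤ : ∀ z {x y} → x ≤ y → z + x ≤ z + y
  +-monoʳ-≤ z (inj₁ x<y) = inj₁ (+-monoʳ-< z x<y)
  +-monoʳ-≤ z (inj₂ x≈y) = inj₂ (Ring.+-congˡ x≈y)

  x-y+y≈x : ∀ x y → x - y + y ≈ x
  x-y+y≈x x y = Algebra.Properties.Group.//-rightDividesˡ Ring.+-group y x

  x+y-y≈x : ∀ x y → x + y - y ≈ x
  x+y-y≈x x y = Algebra.Properties.Group.//-rightDividesʳ Ring.+-group y x

  +-cancelʳ-< : ∀ z {x y} → x + z < y + z → x < y
  +-cancelʳ-< z {x} {y} lt =
    Order.<-respʳ-≈ (x+y-y≈x y z) (Order.<-respˡ-≈ (x+y-y≈x x z) (+-monoˡ-< (- z) lt))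

  x<x+y : ∀ x {y} → 0# < y → x < x + y
  x<x+y x 0<y = Order.<-respˡ-≈ (Ring.+-identityʳ x) (+-monoʳ-< x 0<y)

  x<y+z⇒x-z<y : ∀ {x y z} → x < y + z → x - z < y
  x<y+z⇒x-z<y {x} {y} {z} lt = +-cancelʳ-< z (Order.<-respˡ-≈ (Ring.sym (x-y+y≈x x z)) lt)

  0<1 : 0# < 1#
  0<1 with Order.compare 0# 1#
  ... | tri< lt _ _ = lt
  ... | tri≈ _ eq _ = contradiction eq 0≉1
  ... | tri> _ _ gt = contradiction (Order.<-respʳ-≈ 1≈ (*-pos 0<-1 0<-1)) (Order.asym gt)
    where
    0<-1 : 0# < - 1#
    0<-1 = Order.<-respʳ-≈ (Ring.+-identityˡ (- 1#))
             (Order.<-respˡ-≈ (Ring.-‿inverseʳ 1#) (+-monoˡ-< (- 1#) gt))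
    1≈ : - 1# * - 1# ≈ 1#
    1≈ = Ring.trans (-1*x≈-x (- 1#)) (Algebra.Properties.Group.⁻¹-involutive Ring.+-group 1#)

  half : ∀ {d} → 0# < d → ∃[ e ] 0# < e × e < d
  half {d} 0<d with inverse (1# + 1#) (λ eq → Order.irrefl (Ring.sym eq) (Order.trans 0<1 (x<x+y 1# 0<1)))
  ... | y , [1+1]y≈1 = e , 0<e , Order.<-respʳ-≈ e+e≈d (x<x+y e 0<e)
    where
    e : Carrier
    e = d * y
    e+e≈d : e + e ≈ d
    e+e≈d = begin-equality
      d * y + d * y     ≈⟨ Ring.distribˡ d y y ⟨
      d * (y + y)       ≈⟨ Ring.*-congˡ (Ring.+-cong (Ring.*-identityˡ y) (Ring.*-identityˡ y)) ⟨
      d * (1# * y + 1# * y) ≈⟨ Ring.*-congˡ (Ring.distribʳ y 1# 1#) ⟨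
      d * ((1# + 1#) * y) ≈⟨ Ring.*-congˡ [1+1]y≈1 ⟩
      d * 1#            ≈⟨ Ring.*-identityʳ d ⟩
      d                 ∎
      where open Reasoning
    0<e : 0# < e
    0<e with 0# Order.<? e
    ... | yes lt = lt
    ... | no ≮ = contradiction 0<d (≤⇒≯ (≤-trans (inj₂ (Ring.sym e+e≈d))
                   (≤-trans (+-monoʳ-≤ e (≮⇒≥ ≮)) (≤-trans (inj₂ (Ring.+-identityʳ e)) (≮⇒≥ ≮)))))

  dense : ∀ {x y} → x < y → ∃[ m ] x < m × m < y
  dense {x} {y} x<y with half (Order.<-respˡ-≈ (Ring.-‿inverseʳ x) (+-monoˡ-< (- x) x<y))
  ... | e , 0<e , e<y-x = x + e , x<x+y x 0<e ,
    Order.<-respʳ-≈ (Ring.trans (Ring.+-comm x (y - x)) (x-y+y≈x y x)) (+-monoʳ-< x e<y-x)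

  dense₂ : ∀ {x y z} → x < y → x < z → ∃[ m ] x < m × m < y × m < z
  dense₂ {x} {y} {z} x<y x<z with ≤-total y z
  ... | inj₁ y≤z = let (m , x<m , m<y) = dense x<y in m , x<m , m<y , <-≤-trans m<y y≤z
  ... | inj₂ z≤y = let (m , x<m , m<z) = dense x<z in m , x<m , <-≤-trans m<z z≤y , m<z

-- Touching and disjointness of placed boxes as inequalities between coordinates.

module Geometry {c ℓ₁ ℓ₂} (ℝ : RealNumbers c ℓ₁ ℓ₂) where

  open RealNumbers ℝ
  open OrderedField ℝ public
  open Boxes ℝ public
  open PlacedBox using (box; x; y; width; height) public

  right top : PlacedBox → Carrier
  right p = x p + width p
  top p = y p + height p

  x<right : ∀ p → x p < right p
  x<right p = x<x+y (x p) (PlacedBox.0<width p)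

  y<top : ∀ p → y p < top p
  y<top p = x<x+y (y p) (PlacedBox.0<height p)

  place : Box → Carrier → Carrier → PlacedBox
  place b u v = record { box = b ; x = u ; y = v }

  -- `Touch` compares every side with every side. For boxes with disjoint interiors it reduces to
  -- `Adjacent`, where a shared segment of positive length becomes two strict inequalities. `Apart`
  -- says that some axis separates the boxes.
  Beside Below Adjacent Apart : Rel PlacedBox _
  Beside p q   = right p ≈ x q × y p < top q × y q < top p
  Below p q    = top p ≈ y q × x p < right q × x q < right p
  Adjacent p q = (Beside p q ⊎ Beside q p) ⊎ (Below p q ⊎ Below q p)
  Apart p q    = (right p ≤ x q ⊎ right q ≤ x p) ⊎ (top p ≤ y q ⊎ top q ≤ y p)

  apart-sym : Symmetric Apart
  apart-sym = Sum.map Sum.swap Sum.swap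

  adjacent⇒apart : ∀ p q → Adjacent p q → Apart p q
  adjacent⇒apart p q = Sum.map (Sum.map (inj₂ ∘ proj₁) (inj₂ ∘ proj₁)) (Sum.map (inj₂ ∘ proj₁) (inj₂ ∘ proj₁))

  Overlap : (s t s′ t′ : Carrier) → Set _
  Overlap s t s′ t′ = ∃[ u ] ∃[ v ] u < v × (s ≤ u × v ≤ t) × (s′ ≤ u × v ≤ t′)

  overlap⁺ : ∀ {s t s′ t′} → s < t → s′ < t′ → s < t′ → s′ < t → Overlap s t s′ t′
  overlap⁺ {s} {t} {s′} {t′} s<t s′<t′ s<t′ s′<t with ≤-total s s′ | ≤-total t t′
  ... | inj₁ s≤s′ | inj₁ t≤t′ = s′ , t , s′<t , (s≤s′ , ≤-refl) , (≤-refl , t≤t′)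
  ... | inj₁ s≤s′ | inj₂ t′≤t = s′ , t′ , s′<t′ , (s≤s′ , t′≤t) , (≤-refl , ≤-refl)
  ... | inj₂ s′≤s | inj₁ t≤t′ = s , t , s<t , (≤-refl , ≤-refl) , (s′≤s , t≤t′)
  ... | inj₂ s′≤s | inj₂ t′≤t = s , t′ , s<t′ , (≤-refl , t′≤t) , (s′≤s , ≤-refl)

  overlap⁻ : ∀ {s t s′ t′} → Overlap s t s′ t′ → s < t′ × s′ < t
  overlap⁻ (u , v , u<v , (s≤u , v≤t) , (s′≤u , v≤t′)) =
    <-≤-trans (≤-<-trans s≤u u<v) v≤t′ , <-≤-trans (≤-<-trans s′≤u u<v) v≤t

  overlap-sym : ∀ {s t s′ t′} → Overlap s t s′ t′ → Overlap s′ t′ s t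
  overlap-sym (u , v , u<v , st , st′) = u , v , u<v , st′ , st

  touch-sym : Symmetric Touch
  touch-sym = Any.map (Any.map share-sym) ∘ Any.swap
    where
    share-sym : ∀ {σ τ} → ShareSegment σ τ → ShareSegment τ σ
    share-sym (vertical a≈ ov)   = vertical (Ring.sym a≈) (overlap-sym ov)
    share-sym (horizontal a≈ ov) = horizontal (Ring.sym a≈) (overlap-sym ov)

  beside⇒touch : ∀ p q → Beside p q → Touch p q
  beside⇒touch p q (eq , lt , lt′) =
    there (here (here (vertical eq (overlap⁺ (y<top p) (y<top q) lt lt′))))

  below⇒touch : ∀ p q → Below p q → Touch p q
  below⇒touch p q (eq , lt , lt′) =
    there (there (there (here (there (there (here (horizontal eq (overlap⁺ (x<right p) (x<right q) lt lt′))))))))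

  adjacent⇒touch : ∀ p q → Adjacent p q → Touch p q
  adjacent⇒touch p q (inj₁ (inj₁ a)) = beside⇒touch p q a
  adjacent⇒touch p q (inj₁ (inj₂ a)) = touch-sym {q} {p} (beside⇒touch q p a)
  adjacent⇒touch p q (inj₂ (inj₁ a)) = below⇒touch p q a
  adjacent⇒touch p q (inj₂ (inj₂ a)) = touch-sym {q} {p} (below⇒touch q p a)

  apart⇒¬overlap : ∀ p q → Apart p q → x p < right q → x q < right p → y p < top q → ¬ y q < top p
  apart⇒¬overlap p q (inj₁ (inj₁ le)) _ lt _ _ = ≤⇒≯ le lt
  apart⇒¬overlap p q (inj₁ (inj₂ le)) lt _ _ _ = ≤⇒≯ le lt
  apart⇒¬overlap p q (inj₂ (inj₁ le)) _ _ _ lt = ≤⇒≯ le lt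
  apart⇒¬overlap p q (inj₂ (inj₂ le)) _ _ lt _ = ≤⇒≯ le lt

  ¬overlap⇒apart : ∀ p q → (x p < right q → x q < right p → y p < top q → ¬ y q < top p) → Apart p q
  ¬overlap⇒apart p q ¬ov
    with x p Order.<? right q | x q Order.<? right p | y p Order.<? top q | y q Order.<? top p
  ... | no ≮  | _     | _     | _     = inj₁ (inj₂ (≮⇒≥ ≮))
  ... | yes _ | no ≮  | _     | _     = inj₁ (inj₁ (≮⇒≥ ≮))
  ... | yes _ | yes _ | no ≮  | _     = inj₂ (inj₂ (≮⇒≥ ≮))
  ... | yes _ | yes _ | yes _ | no ≮  = inj₂ (inj₁ (≮⇒≥ ≮))
  ... | yes a | yes b | yes c | yes d = contradiction d (¬ov a b c)

  DisjointInteriors : Rel PlacedBox _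
  DisjointInteriors p q = ∀ u v → ¬ (Interior p u v × Interior q u v)

  apart⇒disjoint : ∀ p q → Apart p q → DisjointInteriors p q
  apart⇒disjoint p q ap u v (((a , b) , (c , d)) , ((a′ , b′) , (c′ , d′))) =
    apart⇒¬overlap p q ap (Order.trans a b′) (Order.trans a′ b) (Order.trans c d′) (Order.trans c′ d)

  -- If no axis separates the boxes, both pairs of projections overlap in an interval of positive
  -- length; density gives an inner point of each, and together these form a common interior point.
  disjoint⇒apart : ∀ p q → DisjointInteriors p q → Apart p q
  disjoint⇒apart p q disj = ¬overlap⇒apart p q λ a b c d →
    let (u , pu , qu) = common (overlap⁺ (x<right p) (x<right q) a b)
        (v , pv , qv) = common (overlap⁺ (y<top p) (y<top q) c d)
    in disj u v ((pu , pv) , (qu , qv))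
    where
    common : ∀ {s t s′ t′} → Overlap s t s′ t′ → ∃[ m ] (s < m × m < t) × (s′ < m × m < t′)
    common (u , v , u<v , (s≤u , v≤t) , (s′≤u , v≤t′)) with dense u<v
    ... | m , u<m , m<v = m , (≤-<-trans s≤u u<m , <-≤-trans m<v v≤t) , (≤-<-trans s′≤u u<m , <-≤-trans m<v v≤t′)

  -- Two sides of the same kind, such as both left sides, cannot share a segment: both boxes would
  -- extend from it in the same direction and overlap. What remains is right against left and top
  -- against bottom.
  touch⇒adjacent : ∀ p q → Apart p q → Touch p q → Adjacent p q
  touch⇒adjacent p q ap = λ where
      (here (here (vertical eq ov))) →
        ⊥-elim (same-x (<-respˡ (Ring.sym eq) (x<right q)) (<-respˡ eq (x<right p)) ov)
      (here (there (here (vertical eq ov)))) →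
        inj₁ (inj₂ (Ring.sym eq , Product.swap (overlap⁻ ov)))
      (here (there (there (here ()))))
      (here (there (there (there (here ())))))
      (there (here (here (vertical eq ov)))) →
        inj₁ (inj₁ (eq , overlap⁻ ov))
      (there (here (there (here (vertical eq ov))))) →
        ⊥-elim (same-x (<-respʳ eq (x<right p)) (<-respʳ (Ring.sym eq) (x<right q)) ov)
      (there (here (there (there (here ())))))
      (there (here (there (there (there (here ()))))))
      (there (there (here (there (there (here (horizontal eq ov))))))) →
        ⊥-elim (same-y (<-respˡ (Ring.sym eq) (y<top q)) (<-respˡ eq (y<top p)) ov)
      (there (there (here (there (there (there (here (horizontal eq ov)))))))) →
        inj₂ (inj₂ (Ring.sym eq , Product.swap (overlap⁻ ov)))
      (there (there (there (here (there (there (here (horizontal eq ov)))))))) →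
        inj₂ (inj₁ (eq , overlap⁻ ov))
      (there (there (there (here (there (there (there (here (horizontal eq ov))))))))) →
        ⊥-elim (same-y (<-respʳ eq (y<top p)) (<-respʳ (Ring.sym eq) (y<top q)) ov)
    where
    <-respˡ : ∀ {u v w} → u ≈ v → u < w → v < w
    <-respˡ = Order.<-respˡ-≈
    <-respʳ : ∀ {u v w} → u ≈ v → w < u → w < v
    <-respʳ = Order.<-respʳ-≈
    same-x : x p < right q → x q < right p → ¬ Overlap (y p) (top p) (y q) (top q)
    same-x a b ov = apart⇒¬overlap p q ap a b (proj₁ (overlap⁻ ov)) (proj₂ (overlap⁻ ov))
    same-y : y p < top q → y q < top p → ¬ Overlap (x p) (right p) (x q) (right q)
    same-y a b ov = apart⇒¬overlap p q ap (proj₁ (overlap⁻ ov)) (proj₂ (overlap⁻ ov)) a b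

  opaque

    touching : List PlacedBox → ℕ
    touching = Pairs.pairs touch?

    contacts≡touching : ∀ {n} {B : BoxSet n} (R : Representation B) →
                        contacts R ≡ touching (tabulate (Representation.placed R))
    contacts≡touching R = Pairs.count-< touch? (Representation.placed R)

    touching-↭ : ∀ {ps qs} → ps ↭ qs → touching ps ≡ touching qs
    touching-↭ = Pairs.pairs-↭ touch? (λ {p} {q} → touch-sym {p} {q})

    touching-≤ : ∀ ps → touching ps ℕ.≤ choose₂ (length ps)
    touching-≤ = Pairs.pairs-≤ touch?

    touching-< : ∀ ps → ¬ AllPairs Touch ps → touching ps ℕ.< choose₂ (length ps)
    touching-< = Pairs.pairs-< touch?

    touching-one : ∀ p q → Touch p q → 1 ℕ.≤ touching (p ∷ q ∷ [])
    touching-one p q pq = ℕ.≤-trans (count-accept (touch? p) {q} {[]} pq ℕ.z≤n) (ℕ.m≤m+n _ _)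

    touching-two : ∀ p q q′ ps → Touch p q → Touch p q′ →
                   2 ℕ.+ touching (q ∷ q′ ∷ ps) ℕ.≤ touching (p ∷ q ∷ q′ ∷ ps)
    touching-two p q q′ ps = Pairs.pairs-two touch? {p} {q} {q′} {ps}

    touching-wheel : ∀ a g f e c →
      Touch a g → Touch a f → Touch a e → Touch g f → Touch g c → Touch f e → Touch f c → Touch e c →
      8 ℕ.≤ touching (a ∷ g ∷ f ∷ e ∷ c ∷ [])
    touching-wheel a g f e c = Pairs.pairs-wheel touch? {a} {g} {f} {e} {c}

-- Growing two rows of boxes along a line, with two contacts per new box.

module Zipper {c ℓ₁ ℓ₂} (ℝ : RealNumbers c ℓ₁ ℓ₂) where

  open RealNumbers ℝ
  open Geometry ℝ

  -- T and D are the last boxes of the rows above and below the line at height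
  -- level.  Everything to the right of T above the line, and to the right of D
  -- below it, is empty.
  record Frontier (T D : PlacedBox) (rest : List PlacedBox) : Set (c ⊔ ℓ₁ ⊔ ℓ₂) where
    field
      level    : Carrier
      T-bottom : y T ≤ level
      T-top    : level < top T
      D-bottom : y D < level
      D-top    : level ≤ top D
      floor    : right T < right D → top D ≈ level × x D ≤ right T
      ceiling  : right D < right T → y T ≈ level × x T ≤ right D
      behind   : All (λ p → (right p ≤ right T ⊎ top p ≤ level) ×
                            (right p ≤ right D ⊎ level ≤ y p)) rest
      apart    : AllPairs Apart (T ∷ D ∷ rest)

  -- The new box `p` becomes the end of one of the two rows, and the box it replaces joins `rest`.
  -- `reorder` records this without saying which row it was.
  record Extension (b : Box) (T D : PlacedBox) (rest : List PlacedBox) : Set (c ⊔ ℓ₁ ⊔ ℓ₂) where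
    field
      p         : PlacedBox
      box-p     : box p ≡ b
      {T′ D′}   : PlacedBox
      {rest′}   : List PlacedBox
      frontier  : Frontier T′ D′ rest′
      reorder   : T′ ∷ D′ ∷ rest′ ↭ p ∷ T ∷ D ∷ rest
      p-T       : Adjacent p T
      p-D       : Adjacent p D

  module _ (b : Box) {T D : PlacedBox} {rest : List PlacedBox} (F : Frontier T D rest) where

    open Frontier F
    open Box b renaming (width to w; height to h; 0<width to 0<w; 0<height to 0<h)

    private
      finish : ∀ {T′ D′ rest′} p → box p ≡ b → (p-T : Adjacent p T) (p-D : Adjacent p D) →
        All (Apart p) rest → T′ ∷ D′ ∷ rest′ ↭ p ∷ T ∷ D ∷ rest →
        (AllPairs Apart (T′ ∷ D′ ∷ rest′) → Frontier T′ D′ rest′) →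
        Extension b T D rest
      finish p eq p-T p-D p-rest ρ frontier′ = record
        { p = p ; box-p = eq ; reorder = ρ ; p-T = p-T ; p-D = p-D
        ; frontier = frontier′ (AllPairs-resp-↭ {R = Apart} (λ {p} {q} → apart-sym {p} {q}) (↭-sym ρ)
            ((adjacent⇒apart p T p-T ∷ adjacent⇒apart p D p-D ∷ p-rest) ∷ apart))
        }

    -- The upper row is the shorter one. By `floor` the top of `D` lies on the line beyond the end
    -- of `T`, so a box put there abuts on `T` sideways and rests on `D`.
    extend-above : right T < right D → Extension b T D rest
    extend-above rT<rD = finish p refl p-T p-D p-rest (↭-prep p (↭-swap D T ↭-refl)) λ ap → record
      { level    = level
      ; T-bottom = ≤-refl
      ; T-top    = x<x+y level 0<h
      ; D-bottom = D-bottom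
      ; D-top    = D-top
      ; floor    = λ _ → top-D≈ , ≤-trans x-D≤ (<⇒≤ rT<)
      ; ceiling  = λ _ → Ring.refl , <⇒≤ rT<rD
      ; behind   = (inj₁ (<⇒≤ rT<) , inj₁ (<⇒≤ rT<rD)) ∷
                   All.map (λ (u , v) → Sum.map₁ (λ le → ≤-trans le (<⇒≤ rT<)) u , v) behind
      ; apart    = ap
      }
      where
      p : PlacedBox
      p = place b (right T) level
      rT< : right T < right p
      rT< = x<x+y (right T) 0<w
      top-D≈ = proj₁ (floor rT<rD)
      x-D≤ = proj₂ (floor rT<rD)
      p-T : Adjacent p T
      p-T = inj₁ (inj₂ (Ring.refl , ≤-<-trans T-bottom (x<x+y level 0<h) , T-top))
      p-D : Adjacent p D
      p-D = inj₂ (inj₂ (top-D≈ , ≤-<-trans x-D≤ rT< , rT<rD))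
      p-rest : All (Apart p) rest
      p-rest = All.map (λ (u , _) → Sum.map inj₂ inj₂ u) behind

    -- The mirror image of `extend-above` in the line: `p` hangs from the line with its top at
    -- `level`, and `ceiling` takes the place of `floor`.
    extend-below : right D < right T → Extension b T D rest
    extend-below rD<rT = finish p refl p-T p-D p-rest (↭-swap T p ↭-refl) λ ap → record
      { level    = level
      ; T-bottom = T-bottom
      ; T-top    = T-top
      ; D-bottom = Order.<-respʳ-≈ top-p≈ (y<top p)
      ; D-top    = inj₂ (Ring.sym top-p≈)
      ; floor    = λ _ → top-p≈ , <⇒≤ rD<rT
      ; ceiling  = λ _ → y-T≈ , ≤-trans x-T≤ (<⇒≤ rD<)
      ; behind   = (inj₁ (<⇒≤ rD<rT) , inj₁ (<⇒≤ rD<)) ∷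
                   All.map (λ (u , v) → u , Sum.map₁ (λ le → ≤-trans le (<⇒≤ rD<)) v) behind
      ; apart    = ap
      }
      where
      p : PlacedBox
      p = place b (right D) (level - h)
      top-p≈ : top p ≈ level
      top-p≈ = x-y+y≈x level h
      rD< : right D < right p
      rD< = x<x+y (right D) 0<w
      y-T≈ = proj₁ (ceiling rD<rT)
      x-T≤ = proj₂ (ceiling rD<rT)
      p-T : Adjacent p T
      p-T = inj₂ (inj₁ (Ring.trans top-p≈ (Ring.sym y-T≈) , rD<rT , ≤-<-trans x-T≤ rD<))
      p-D : Adjacent p D
      p-D = inj₁ (inj₂ (Ring.refl , Order.<-respʳ-≈ (Ring.sym top-p≈) D-bottom ,
                        <-≤-trans (Order.<-respʳ-≈ top-p≈ (y<top p)) D-top))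
      p-rest : All (Apart p) rest
      p-rest = All.map (λ (_ , v) → Sum.map inj₂ (λ le → inj₁ (≤-trans (inj₂ top-p≈) le)) v) behind

    extend-across : right T ≈ right D → Extension b T D rest
    -- `level′` will be the top of `p` and the new line. It is below the top of `T`, so `T` still
    -- ends the upper row, and less than `h` above the old line, so `p` reaches down past that line
    -- and touches `D`. Then `p` ends the lower row.
    extend-across rT≈rD with dense₂ T-top (x<x+y level 0<h)
    ... | level′ , l<l′ , l′<top , l′<l+h =
      finish p refl p-T p-D p-rest (↭-swap T p ↭-refl) λ ap → record
      { level    = level′
      ; T-bottom = ≤-trans T-bottom (<⇒≤ l<l′)
      ; T-top    = l′<top
      ; D-bottom = Order.trans y-p< l<l′
      ; D-top    = inj₂ (Ring.sym top-p≈)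
      ; floor    = λ _ → top-p≈ , ≤-refl
      ; ceiling  = λ lt → ⊥-elim (Order.asym lt rT<)
      ; behind   = (inj₁ (inj₂ (Ring.sym rT≈rD)) , inj₁ (≤-trans (inj₂ (Ring.sym rT≈rD)) (<⇒≤ rT<))) ∷
                   All.map (λ le → inj₁ le , inj₁ (≤-trans le (<⇒≤ rT<))) left
      ; apart    = ap
      }
      where
      p : PlacedBox
      p = place b (right T) (level′ - h)
      top-p≈ : top p ≈ level′
      top-p≈ = x-y+y≈x level′ h
      y-p< : y p < level
      y-p< = x<y+z⇒x-z<y l′<l+h
      rT< : right T < right p
      rT< = x<x+y (right T) 0<w
      -- A box could extend beyond the common end only by lying both below and above the line, which
      -- its positive height forbids.
      left : All (λ q → right q ≤ right T) rest
      left = All.map (λ {q} → cases q) behind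
        where
        cases : ∀ q → (right q ≤ right T ⊎ top q ≤ level) × (right q ≤ right D ⊎ level ≤ y q) →
                right q ≤ right T
        cases q (inj₁ le , _)        = le
        cases q (inj₂ _ , inj₁ le)   = ≤-trans le (inj₂ (Ring.sym rT≈rD))
        cases q (inj₂ le , inj₂ le′) = ⊥-elim (≤⇒≯ (≤-trans le le′) (y<top q))
      p-T : Adjacent p T
      p-T = inj₁ (inj₂ (Ring.refl , Order.<-respʳ-≈ (Ring.sym top-p≈) (≤-<-trans T-bottom l<l′) ,
                        Order.trans y-p< T-top))
      p-D : Adjacent p D
      p-D = inj₁ (inj₂ (Ring.sym rT≈rD , Order.<-respʳ-≈ (Ring.sym top-p≈) (Order.trans D-bottom l<l′) ,
                        <-≤-trans y-p< D-top))
      p-rest : All (Apart p) rest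
      p-rest = All.map (inj₁ ∘ inj₂) left

    extend : Extension b T D rest
    extend with Order.compare (right T) (right D)
    ... | tri< lt _ _ = extend-above lt
    ... | tri≈ _ eq _ = extend-across eq
    ... | tri> _ _ gt = extend-below gt

  -- Each box is added in front of `T` and `D`, both of which it touches, so `touching-two` gives
  -- two new contacts; `touching-↭` then moves the count to the order of the next frontier.
  extend-all : ∀ bs {T D rest} → Frontier T D rest →
    ∃[ ps ] (map box ps ↭ bs ++ map box (T ∷ D ∷ rest)) × AllPairs Apart ps ×
            2 ℕ.* length bs ℕ.+ touching (T ∷ D ∷ rest) ℕ.≤ touching ps
  extend-all [] {T} {D} {rest} F = T ∷ D ∷ rest , ↭-refl , Frontier.apart F , ℕ.≤-refl
  extend-all (b ∷ bs) {T} {D} {rest} F with extend b F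
  ... | record { p = p ; box-p = refl ; T′ = T′ ; D′ = D′ ; rest′ = rest′
               ; frontier = F′ ; reorder = ρ ; p-T = p-T ; p-D = p-D }
    with extend-all bs F′
  ...   | ps , σ , ap , le = ps , σ′ , ap , le′
    where
    old = T ∷ D ∷ rest
    σ′ : map box ps ↭ box p ∷ bs ++ map box old
    σ′ = ↭-trans σ (↭-trans (++⁺ˡ bs (map⁺ box ρ)) (shift (box p) bs (map box old)))
    le′ : 2 ℕ.* suc (length bs) ℕ.+ touching old ℕ.≤ touching ps
    le′ = begin
      2 ℕ.* suc (length bs) ℕ.+ touching old
        ≡⟨ cong (ℕ._+ touching old) (≡.trans (ℕ.*-suc 2 (length bs)) (ℕ.+-comm 2 (2 ℕ.* length bs))) ⟩
      2 ℕ.* length bs ℕ.+ 2 ℕ.+ touching old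
        ≡⟨ ℕ.+-assoc (2 ℕ.* length bs) 2 (touching old) ⟩
      2 ℕ.* length bs ℕ.+ (2 ℕ.+ touching old)
        ≤⟨ ℕ.+-monoʳ-≤ (2 ℕ.* length bs) (touching-two p T D rest (adjacent⇒touch p T p-T) (adjacent⇒touch p D p-D)) ⟩
      2 ℕ.* length bs ℕ.+ touching (p ∷ old)
        ≡⟨ cong (2 ℕ.* length bs ℕ.+_) (touching-↭ ρ) ⟨
      2 ℕ.* length bs ℕ.+ touching (T′ ∷ D′ ∷ rest′)
        ≤⟨ le ⟩
      touching ps ∎
      where open ℕ.≤-Reasoning

  tabulate-placed : ∀ {n} (f : Fin n → Box) ps → tabulate f ≡ map box ps →
    ∃₂ λ (u v : Fin n → Carrier) → tabulate (λ i → place (f i) (u i) (v i)) ≡ ps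
  tabulate-placed {zero}  f []       eq = (λ ()) , (λ ()) , refl
  tabulate-placed {suc n} f (p ∷ ps) eq with ∷-injective eq
  ... | eq₀ , eqs with tabulate-placed (f ∘ suc) ps eqs
  ...   | u , v , refl = (λ { zero → x p ; (suc i) → u i }) , (λ { zero → y p ; (suc i) → v i }) ,
    cong (λ b → place b (x p) (y p) ∷ ps) eq₀

  -- The construction lists placed boxes in its own order, whereas a representation follows the
  -- indices of `B`. The permutation of boxes is lifted to one of placed boxes, from which the
  -- coordinates are read off.
  realise : ∀ {n} (B : BoxSet n) {ps} → map box ps ↭ tabulate (BoxSet.box B) → AllPairs Apart ps →
            ∃[ R ] contacts {B = B} R ≡ touching ps
  realise B {ps} ρ ap with ↭-map-inv box ρ
  ... | qs , eq , σ with tabulate-placed (BoxSet.box B) qs eq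
  ...   | u , v , refl =
    R , ≡.trans (contacts≡touching R) (≡.sym (touching-↭ σ))
    where
    R : Representation B
    R = record
      { x        = u
      ; y        = v
      ; disjoint = λ {i} {j} i≢j →
          apart⇒disjoint (place (BoxSet.box B i) (u i) (v i)) (place (BoxSet.box B j) (u j) (v j))
            (AllPairs-tabulate⁻ {R = Apart} (λ {p} {q} → apart-sym {p} {q})
              (AllPairs-resp-↭ {R = Apart} (λ {p} {q} → apart-sym {p} {q}) σ ap) i≢j)
      }

-- Five boxes with eight contacts: one box surrounded by four.

module Core {c ℓ₁ ℓ₂} (ℝ : RealNumbers c ℓ₁ ℓ₂) where

  open RealNumbers ℝ
  open Geometry ℝ
  open Zipper ℝ
  open Box renaming (width to w; height to h)

  record Surround (A G F E C : PlacedBox) : Set (c ⊔ ℓ₁ ⊔ ℓ₂) where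
    field
      A-G : Adjacent A G
      A-F : Adjacent A F
      A-E : Adjacent A E
      A-C : Apart A C
      G-F : Adjacent G F
      G-E : Apart G E
      G-C : Adjacent G C
      F-E : Adjacent F E
      F-C : Adjacent F C
      E-C : Adjacent E C

    apart : AllPairs Apart (A ∷ G ∷ F ∷ E ∷ C ∷ [])
    apart = (adjacent⇒apart A G A-G ∷ adjacent⇒apart A F A-F ∷ adjacent⇒apart A E A-E ∷ A-C ∷ []) ∷
            (adjacent⇒apart G F G-F ∷ G-E ∷ adjacent⇒apart G C G-C ∷ []) ∷
            (adjacent⇒apart F E F-E ∷ adjacent⇒apart F C F-C ∷ []) ∷
            (adjacent⇒apart E C E-C ∷ []) ∷ [] ∷ []

    eight : 8 ℕ.≤ touching (A ∷ G ∷ F ∷ E ∷ C ∷ [])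
    eight = touching-wheel A G F E C
      (adjacent⇒touch A G A-G) (adjacent⇒touch A F A-F) (adjacent⇒touch A E A-E) (adjacent⇒touch G F G-F)
      (adjacent⇒touch G C G-C) (adjacent⇒touch F E F-E) (adjacent⇒touch F C F-C) (adjacent⇒touch E C E-C)

  -- Eight is 2·5 - 2, and the frontier allows further boxes to be added at two contacts each.
  Core : List Box → Set (c ⊔ ℓ₁ ⊔ ℓ₂)
  Core bs = ∃[ T ] ∃[ D ] ∃[ rest ] Frontier T D rest × (map box (T ∷ D ∷ rest) ↭ bs) ×
            8 ℕ.≤ touching (T ∷ D ∷ rest)

  -- The right end of the longer interval is put at a point `u` between `s + m` and `s + n`; its
  -- left end `u - n` then falls before `s`.
  overhang : ∀ s {m n} → m < n → ∃[ t ] t < s × s + m < t + n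
  overhang s {m} {n} m<n with dense (+-monoʳ-< s m<n)
  ... | u , lt , lt′ = u - n , x<y+z⇒x-z<y lt′ , <-≈-trans lt (Ring.sym (x-y+y≈x u n))

  module _ (f e g a c : Box) where

    private
      F : PlacedBox
      F = place f 0# 0#
      0<rF : 0# < right F
      0<rF = x<right F
      0<tF : 0# < top F
      0<tF = y<top F

    -- F lies between E (left), A (above), G (right) and C (below).  At each corner
    -- of F one of the two neighbours passes the corner and the other abuts on it.
    -- E and G are taller than F; if A or C is as wide as F, they pass it on both sides.
    module PinwheelLayout (ye L : Carrier) where

      E A G C : PlacedBox
      E = place e (0# - w e) ye
      A = place a 0# (top F)
      G = place g (right F) (L - h g)
      C = place c (right F - w c) (0# - h c)

      rE : right E ≈ 0#
      rE = x-y+y≈x 0# (w e)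
      rC : right C ≈ right F
      rC = x-y+y≈x (right F) (w c)
      tC : top C ≈ 0#
      tC = x-y+y≈x 0# (h c)
      tG : top G ≈ L
      tG = x-y+y≈x L (h g)

      -- Two corners of `F` are settled by the placement: `E` passes the upper left one and `A`
      -- abuts on it, `G` passes the lower right one and `C` abuts on it. The first disjunction lets
      -- `C` or `E` pass the lower left corner, the second lets `A` or `G` pass the upper right one.
      layout : top F < top E → y G < 0# → right F ≤ right A →
               (ye ≈ 0# × x C < 0#) ⊎ (ye < 0# × x C ≈ 0#) →
               (L ≈ top F × right F < right A) ⊎ (top F < L × L < top A × right A ≈ right F) →
               Core (a ∷ g ∷ f ∷ e ∷ c ∷ [])
      layout tF<tE yG<0 rF≤rA left above =
        A , G , F ∷ E ∷ C ∷ [] , frontier , ↭-refl , Surround.eight surround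
        where
        ye≤0 : ye ≤ 0#
        ye≤0 = [ inj₂ ∘ proj₁ , inj₁ ∘ proj₁ ] left
        tF≤L : top F ≤ L
        tF≤L = [ inj₂ ∘ Ring.sym ∘ proj₁ , inj₁ ∘ proj₁ ] above
        L<tA : L < top A
        L<tA = [ (λ (eq , _) → ≈-<-trans eq (y<top A)) , proj₁ ∘ proj₂ ] above
        0<L : 0# < L
        0<L = <-≤-trans 0<tF tF≤L
        0<tG : 0# < top G
        0<tG = <-≈-trans 0<L (Ring.sym tG)
        0<rG : 0# < right G
        0<rG = Order.trans 0<rF (x<right G)
        0<tA : 0# < top A
        0<tA = Order.trans 0<tF (y<top A)
        yC<0 : y C < 0#
        yC<0 = <-≈-trans (y<top C) tC

        surround : Surround A G F E C
        surround = record
          { A-G = [ (λ (eq , lt) → inj₂ (inj₂ (Ring.trans tG eq , lt , 0<rG)))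
                  , (λ (lt , _ , eq) → inj₁ (inj₁ (eq , <-≈-trans lt (Ring.sym tG) , Order.trans yG<0 0<tA)))
                  ] above
          ; A-F = inj₂ (inj₂ (Ring.refl , x<right A , 0<rF))
          ; A-E = inj₁ (inj₂ (rE , ≤-<-trans ye≤0 0<tA , tF<tE))
          ; A-C = inj₂ (inj₂ (≤-trans (inj₂ tC) (<⇒≤ 0<tF)))
          ; G-F = inj₁ (inj₂ (Ring.refl , 0<tG , Order.trans yG<0 0<tF))
          ; G-E = inj₁ (inj₂ (≤-trans (inj₂ rE) (<⇒≤ 0<rF)))
          ; G-C = inj₁ (inj₂ (rC , Order.trans yC<0 0<tG , <-≈-trans yG<0 (Ring.sym tC)))
          ; F-E = inj₁ (inj₂ (rE , ≤-<-trans ye≤0 0<tF , Order.trans 0<tF tF<tE))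
          ; F-C = inj₂ (inj₂ (tC , <-≈-trans (x<right C) rC , <-≈-trans 0<rF (Ring.sym rC)))
          ; E-C = [ (λ (eq , lt) → inj₂ (inj₂ (Ring.trans tC (Ring.sym eq) , <-≈-trans lt (Ring.sym rE) ,
                      Order.trans (<-≈-trans (x<right E) rE) (<-≈-trans 0<rF (Ring.sym rC)))))
                  , (λ (lt , eq) → inj₁ (inj₁ (Ring.trans rE (Ring.sym eq) , <-≈-trans lt (Ring.sym tC) ,
                      Order.trans yC<0 (Order.trans 0<tF tF<tE))))
                  ] left
          }

        frontier : Frontier A G (F ∷ E ∷ C ∷ [])
        frontier = record
          { level    = L
          ; T-bottom = tF≤L
          ; T-top    = L<tA
          ; D-bottom = Order.trans yG<0 0<L
          ; D-top    = inj₂ (Ring.sym tG)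
          ; floor    = λ _ → tG , rF≤rA
          -- If `G` passes the corner, `A` ends above the right end of `F`, to the left of the end
          -- of `G`, so this case cannot arise.
          ; ceiling  = λ rG<rA → [ (λ (eq , _) → Ring.sym eq , <⇒≤ 0<rG)
                                 , (λ (_ , _ , eq) → ⊥-elim (Order.asym (<-≈-trans rG<rA eq) (x<right G)))
                                 ] above
          ; behind   = (inj₁ rF≤rA , inj₁ (<⇒≤ (x<right G)))
                     ∷ (inj₁ (≤-trans (inj₂ rE) (<⇒≤ (x<right A))) , inj₁ (≤-trans (inj₂ rE) (<⇒≤ 0<rG)))
                     ∷ (inj₁ (≤-trans (inj₂ rC) rF≤rA) , inj₁ (≤-trans (inj₂ rC) (<⇒≤ (x<right G))))
                     ∷ []
          ; apart    = Surround.apart surround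
          }

    pinwheel : h f < h e → h f < h g → w f ≤ w a → w f ≤ w c → Core (a ∷ g ∷ f ∷ e ∷ c ∷ [])
    pinwheel he hg wa wc = build (chooseE wc) (chooseL wa)
      where
      ChoiceE ChoiceL : Carrier → Set _
      ChoiceE ye = 0# + h f < ye + h e ×
        ((ye ≈ 0# × right F - w c < 0#) ⊎ (ye < 0# × right F - w c ≈ 0#))
      ChoiceL L = L < 0# + h g ×
        ((L ≈ top F × right F < 0# + w a) ⊎ (top F < L × L < top F + h a × 0# + w a ≈ right F))
      chooseE : w f ≤ w c → ∃ ChoiceE
      -- A wider `C` overhangs the lower left corner and `E` stands on it. If `C` is only as wide as
      -- `F`, it is flush with `F`, and `E` is lowered so as to exceed `F` at both ends.
      chooseE (inj₁ lt) = 0# , +-monoʳ-< 0# he , inj₁ (Ring.refl , x<y+z⇒x-z<y (+-monoʳ-< 0# lt))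
      chooseE (inj₂ eq) = let (t , t<0 , lt) = overhang 0# he in
        t , lt , inj₂ (t<0 , Ring.trans (Ring.+-congʳ (Ring.+-congˡ eq)) (x+y-y≈x 0# (w c)))
      chooseL : w f ≤ w a → ∃ ChoiceL
      chooseL (inj₁ lt) = top F , +-monoʳ-< 0# hg , inj₁ (Ring.refl , +-monoʳ-< 0# lt)
      -- `A` is as wide as `F`, so `G` has to pass the corner: `L` exceeds the top of `F`. It stays
      -- below the top of `A`, so that `A` crosses the line, and below the height of `G`, so that
      -- `G` still reaches under the bottom of `F`.
      chooseL (inj₂ eq) = let (L , lt , lt′ , lt″) = dense₂ (x<x+y (top F) (0<height a)) (+-monoʳ-< 0# hg) in
        L , lt″ , inj₂ (lt , lt′ , Ring.+-congˡ (Ring.sym eq))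
      build : ∃ ChoiceE → ∃ ChoiceL → Core (a ∷ g ∷ f ∷ e ∷ c ∷ [])
      build (ye , lt , left) (L , lt′ , above) =
        PinwheelLayout.layout ye L lt (x<y+z⇒x-z<y lt′) (+-monoʳ-≤ 0# wa) left above

    -- E is as tall as F, so A and C have to reach over the left side of F.
    module SandwichLayout (xa M : Carrier) where

      E A G C : PlacedBox
      E = place e (0# - w e) 0#
      A = place a xa (top F)
      G = place g (right F) (top F - h g)
      C = place c (M - w c) (0# - h c)

      rE : right E ≈ 0#
      rE = x-y+y≈x 0# (w e)
      rC : right C ≈ M
      rC = x-y+y≈x M (w c)
      tC : top C ≈ 0#
      tC = x-y+y≈x 0# (h c)
      tG : top G ≈ top F
      tG = x-y+y≈x (top F) (h g)

      -- The tops of `E`, `F` and `G` form one line, which carries `A`. At the lower right corner of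
      -- `F` either `G` hangs lower and `C` ends against it, or `G` is as tall as `F` and `C`
      -- reaches under it. `M ≤ right G` keeps `C` behind the frontier.
      layout : top E ≈ top F → xa < 0# → right F < right A → x C < 0# →
               (M ≈ right F × y G < 0#) ⊎ (right F < M × M ≤ right G × y G ≈ 0#) →
               Core (a ∷ g ∷ f ∷ e ∷ c ∷ [])
      layout tE xa<0 rF<rA xC<0 corner =
        A , G , F ∷ E ∷ C ∷ [] , frontier , ↭-refl , Surround.eight surround
        where
        yG≤0 : y G ≤ 0#
        yG≤0 = [ inj₁ ∘ proj₂ , inj₂ ∘ proj₂ ∘ proj₂ ] corner
        rF≤M : right F ≤ M
        rF≤M = [ inj₂ ∘ Ring.sym ∘ proj₁ , inj₁ ∘ proj₁ ] corner
        M≤rG : M ≤ right G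
        M≤rG = [ (λ (eq , _) → ≤-trans (inj₂ eq) (<⇒≤ (x<right G))) , proj₁ ∘ proj₂ ] corner
        0<tG : 0# < top G
        0<tG = <-≈-trans 0<tF (Ring.sym tG)
        0<rG : 0# < right G
        0<rG = Order.trans 0<rF (x<right G)
        0<rA : 0# < right A
        0<rA = Order.trans 0<rF rF<rA
        0<rC : 0# < right C
        0<rC = <-≈-trans (<-≤-trans 0<rF rF≤M) (Ring.sym rC)
        xE<0 : x E < 0#
        xE<0 = <-≈-trans (x<right E) rE
        yC<0 : y C < 0#
        yC<0 = <-≈-trans (y<top C) tC

        surround : Surround A G F E C
        surround = record
          { A-G = inj₂ (inj₂ (tG , rF<rA , Order.trans xa<0 0<rG))
          ; A-F = inj₂ (inj₂ (Ring.refl , 0<rA , Order.trans xa<0 0<rF))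
          ; A-E = inj₂ (inj₂ (tE , Order.trans xE<0 0<rA , <-≈-trans xa<0 (Ring.sym rE)))
          ; A-C = inj₂ (inj₂ (≤-trans (inj₂ tC) (<⇒≤ 0<tF)))
          ; G-F = inj₁ (inj₂ (Ring.refl , 0<tG , ≤-<-trans yG≤0 0<tF))
          ; G-E = inj₁ (inj₂ (≤-trans (inj₂ rE) (<⇒≤ 0<rF)))
          ; G-C = [ (λ (eq , lt) → inj₁ (inj₂ (Ring.trans rC eq , Order.trans yC<0 0<tG ,
                      <-≈-trans lt (Ring.sym tC))))
                  , (λ (lt , _ , eq) → inj₂ (inj₂ (Ring.trans tC (Ring.sym eq) , Order.trans xC<0 0<rG ,
                      <-≈-trans lt (Ring.sym rC))))
                  ] corner
          ; F-E = inj₁ (inj₂ (rE , 0<tF , <-≈-trans 0<tF (Ring.sym tE)))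
          ; F-C = inj₂ (inj₂ (tC , Order.trans xC<0 0<rF , 0<rC))
          ; E-C = inj₂ (inj₂ (tC , <-≈-trans xC<0 (Ring.sym rE) , Order.trans xE<0 0<rC))
          }

        frontier : Frontier A G (F ∷ E ∷ C ∷ [])
        frontier = record
          { level    = top F
          ; T-bottom = ≤-refl
          ; T-top    = y<top A
          ; D-bottom = ≤-<-trans yG≤0 0<tF
          ; D-top    = inj₂ (Ring.sym tG)
          ; floor    = λ _ → tG , <⇒≤ rF<rA
          ; ceiling  = λ _ → Ring.refl , <⇒≤ (Order.trans xa<0 0<rG)
          ; behind   = (inj₁ (<⇒≤ rF<rA) , inj₁ (<⇒≤ (x<right G)))
                     ∷ (inj₁ (≤-trans (inj₂ rE) (<⇒≤ 0<rA)) , inj₁ (≤-trans (inj₂ rE) (<⇒≤ 0<rG)))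
                     ∷ (inj₂ (≤-trans (inj₂ tC) (<⇒≤ 0<tF)) , inj₁ (≤-trans (inj₂ rC) M≤rG))
                     ∷ []
          ; apart    = Surround.apart surround
          }

    sandwich : h f ≈ h e → h f ≤ h g → w f < w a → w f < w c → Core (a ∷ g ∷ f ∷ e ∷ c ∷ [])
    sandwich he hg wa wc with overhang 0# wa
    ... | xa , xa<0 , lt = build (chooseM hg)
      where
      ChoiceM : Carrier → Set _
      ChoiceM M = M - w c < 0# ×
        ((M ≈ right F × top F - h g < 0#) ⊎ (right F < M × M ≤ right F + w g × top F - h g ≈ 0#))
      chooseM : h f ≤ h g → ∃ ChoiceM
      chooseM (inj₁ lt) = right F , x<y+z⇒x-z<y (+-monoʳ-< 0# wc) ,
        inj₁ (Ring.refl , x<y+z⇒x-z<y (+-monoʳ-< 0# lt))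
      -- `G` is as tall as `F`, so the right end `M` of `C` has to lie strictly beyond `F`. The
      -- other two bounds keep it within the width of `G` and let the left end of `C` stay to the
      -- left of 0.
      chooseM (inj₂ eq) = let (M , lt , lt′ , lt″) = dense₂ (x<x+y (right F) (0<width g)) (+-monoʳ-< 0# wc) in
        M , x<y+z⇒x-z<y lt″ ,
        inj₂ (lt , <⇒≤ lt′ , Ring.trans (Ring.+-congʳ (Ring.+-congˡ eq)) (x+y-y≈x 0# (h g)))
      build : ∃ ChoiceM → Core (a ∷ g ∷ f ∷ e ∷ c ∷ [])
      build (M , lt′ , corner) =
        SandwichLayout.layout xa M (Ring.+-congˡ (Ring.sym he)) xa<0 lt lt′ corner

-- The lower bounds 2n - 3 and 2n - 2 for every set of boxes.

module LowerBound {c ℓ₁ ℓ₂} (ℝ : RealNumbers c ℓ₁ ℓ₂) where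

  open RealNumbers ℝ
  open Geometry ℝ
  open Zipper ℝ
  open Core ℝ
  open Box renaming (width to w; height to h)

  -- ≼ breaks ties by height: a box that is as wide as the ≼-least one is
  -- then taller, and so are the two tallest boxes.
  Distinct _≽_ _≼_ : Rel Box _
  Distinct b b′ = ¬ (w b ≈ w b′ × h b ≈ h b′)
  b ≽ b′        = h b′ ≤ h b
  b ≼ b′        = w b < w b′ ⊎ (w b ≈ w b′ × h b ≤ h b′)

  ≼-trans : Transitive _≼_
  ≼-trans (inj₁ lt)       (inj₁ lt′)        = inj₁ (Order.trans lt lt′)
  ≼-trans (inj₁ lt)       (inj₂ (eq , _))   = inj₁ (<-≈-trans lt eq)
  ≼-trans (inj₂ (eq , _)) (inj₁ lt)         = inj₁ (≈-<-trans eq lt)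
  ≼-trans (inj₂ (eq , le)) (inj₂ (eq′ , le′)) = inj₂ (Ring.trans eq eq′ , ≤-trans le le′)

  ≼-total : Total _≼_
  ≼-total b b′ with Order.compare (w b) (w b′)
  ... | tri< lt _ _ = inj₁ (inj₁ lt)
  ... | tri> _ _ gt = inj₂ (inj₁ gt)
  ... | tri≈ _ eq _ = Sum.map (λ le → inj₂ (eq , le)) (λ le → inj₂ (Ring.sym eq , le)) (≤-total (h b) (h b′))

  select : ∀ {r} {_⊑_ : Rel Box r} → Transitive _⊑_ → Total _⊑_ → ∀ {n} bs → length bs ≡ suc n →
           ∃₂ λ m ms → (bs ↭ m ∷ ms) × All (m ⊑_) ms × length ms ≡ n
  select tr tot (b ∷ bs) eq with selectMin tr tot b bs
  ... | m , ms , ρ , m⊑ = m , ms , ρ , m⊑ , ℕ.suc-injective (≡.trans (≡.sym (↭-length ρ)) eq)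

  -- `e` and `g` are the two tallest boxes and `f` is the `≼`-least of the other three. If `a` or
  -- `c` is only as wide as `f`, it is strictly taller, hence so are `e` and `g`, and the pinwheel
  -- applies. If both are strictly wider, the sandwich covers the case that `e` or `g` is as tall as
  -- `f`, and the pinwheel the rest.
  core : ∀ bs → length bs ≡ 5 → AllPairs Distinct bs → Core bs
  core bs len dist
    with select {_⊑_ = _≽_} (λ p q → ≤-trans q p) (λ b b′ → ≤-total (h b′) (h b)) bs len
  ... | e , bs₁ , ρ₁ , e≽ , len₁
    with select {_⊑_ = _≽_} (λ p q → ≤-trans q p) (λ b b′ → ≤-total (h b′) (h b)) bs₁ len₁
  ... | g , bs₂ , ρ₂ , g≽ , len₂
    with select {_⊑_ = _≼_} (λ {b} {b′} {b″} → ≼-trans {b} {b′} {b″}) ≼-total bs₂ len₂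
  ... | f , a ∷ c ∷ [] , ρ₃ , fa ∷ fc ∷ [] , refl = recast (arrange fa fc below-e below-g)
    where
    ρ : bs ↭ e ∷ g ∷ f ∷ a ∷ c ∷ []
    ρ = ↭-trans ρ₁ (↭-prep e (↭-trans ρ₂ (↭-prep g ρ₃)))

    recast : Core (a ∷ g ∷ f ∷ e ∷ c ∷ []) → Core bs
    recast (T , D , rest , F , σ , le) = T , D , rest , F , ↭-trans σ (↭-trans τ (↭-sym ρ)) , le
      where
      τ : a ∷ g ∷ f ∷ e ∷ c ∷ [] ↭ e ∷ g ∷ f ∷ a ∷ c ∷ []
      τ = ↭-trans (↭-prep a (shift e (g ∷ f ∷ []) (c ∷ [])))
          (↭-trans (↭-swap a e ↭-refl) (↭-prep e (↭-sym (shift a (g ∷ f ∷ []) (c ∷ [])))))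

    distinct-f : Distinct f a × Distinct f c
    distinct-f with AllPairs-resp-↭ {R = Distinct} (λ ne (p , q) → ne (Ring.sym p , Ring.sym q)) ρ dist
    ... | _ ∷ _ ∷ (ne ∷ ne′ ∷ []) ∷ _ = ne , ne′

    below-e : All (λ b → h b ≤ h e) (f ∷ a ∷ c ∷ [])
    below-e = All-resp-↭ ρ₃ (All.tail (All-resp-↭ ρ₂ e≽))

    below-g : All (λ b → h b ≤ h g) (f ∷ a ∷ c ∷ [])
    below-g = All-resp-↭ ρ₃ g≽

    wider : ∀ b → f ≼ b → w f ≤ w b
    wider b (inj₁ lt)       = inj₁ lt
    wider b (inj₂ (eq , _)) = inj₂ eq

    taller : ∀ b → Distinct f b → w f ≈ w b × h f ≤ h b → h f < h b
    taller b ne (eq , inj₁ lt)  = lt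
    taller b ne (eq , inj₂ eq′) = ⊥-elim (ne (eq , eq′))

    recastEG : Core (a ∷ e ∷ f ∷ g ∷ c ∷ []) → Core (a ∷ g ∷ f ∷ e ∷ c ∷ [])
    recastEG (T , D , rest , F , σ , le) = T , D , rest , F ,
      ↭-trans σ (↭-prep a (↭-trans (↭-prep e (↭-swap f g ↭-refl))
        (↭-trans (↭-swap e g ↭-refl) (↭-prep g (↭-swap e f ↭-refl))))) , le

    tall : h f < h e → h f < h g → Core (a ∷ g ∷ f ∷ e ∷ c ∷ [])
    tall he hg = pinwheel f e g a c he hg (wider a fa) (wider c fc)

    arrange : f ≼ a → f ≼ c → All (λ b → h b ≤ h e) (f ∷ a ∷ c ∷ []) → All (λ b → h b ≤ h g) (f ∷ a ∷ c ∷ []) →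
              Core (a ∷ g ∷ f ∷ e ∷ c ∷ [])
    arrange (inj₂ eq) _ (_ ∷ ae ∷ _) (_ ∷ ag ∷ _) =
      let lt = taller a (proj₁ distinct-f) eq in tall (<-≤-trans lt ae) (<-≤-trans lt ag)
    arrange _ (inj₂ eq) (_ ∷ _ ∷ ce ∷ []) (_ ∷ _ ∷ cg ∷ []) =
      let lt = taller c (proj₂ distinct-f) eq in tall (<-≤-trans lt ce) (<-≤-trans lt cg)
    arrange (inj₁ wa) (inj₁ wc) (inj₂ he ∷ _) (hg ∷ _)      = sandwich f e g a c he hg wa wc
    -- Here `g` instead of `e` is as tall as `f`, so the two exchange their places in the sandwich.
    arrange (inj₁ wa) (inj₁ wc) (inj₁ he ∷ _) (inj₂ hg ∷ _) = recastEG (sandwich f g e a c hg (inj₁ he) wa wc)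
    arrange (inj₁ wa) (inj₁ wc) (inj₁ he ∷ _) (inj₁ hg ∷ _) = tall he hg

  stack : ∀ b b′ →
    ∃₂ λ T D → Frontier T D [] × (map box (T ∷ D ∷ []) ≡ b ∷ b′ ∷ []) × 1 ℕ.≤ touching (T ∷ D ∷ [])
  stack b b′ = T , D , frontier , refl ,
    touching-one T D (adjacent⇒touch T D T-D)
    where
    D T : PlacedBox
    D = place b′ 0# 0#
    T = place b 0# (top D)
    T-D : Adjacent T D
    T-D = inj₂ (inj₂ (Ring.refl , x<right T , x<right D))
    frontier : Frontier T D []
    frontier = record
      { level    = top D
      ; T-bottom = ≤-refl
      ; T-top    = y<top T
      ; D-bottom = y<top D
      ; D-top    = ≤-refl
      ; floor    = λ _ → Ring.refl , <⇒≤ (x<right T)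
      ; ceiling  = λ _ → Ring.refl , <⇒≤ (x<right D)
      ; behind   = []
      ; apart    = (adjacent⇒apart T D T-D ∷ []) ∷ [] ∷ []
      }

  -- `bs₀` holds the boxes of the starting configuration, with `k` contacts; those in `bs` are still
  -- to be added to the rows.
  build : ∀ {n} (B : BoxSet n) {T D rest bs₀ bs k} → Frontier T D rest →
    tabulate (BoxSet.box B) ≡ bs₀ ++ bs → map box (T ∷ D ∷ rest) ↭ bs₀ → k ℕ.≤ touching (T ∷ D ∷ rest) →
    (2 ℕ.* length bs ℕ.+ k) ≤MaxContacts B
  build B {bs₀ = bs₀} {bs} F eq σ k≤ with extend-all bs F
  ... | ps , ρ , ap , le
    with realise B {ps} (↭-trans ρ (↭-trans (++⁺ˡ bs σ)
           (↭-trans (++-comm bs bs₀) (↭-reflexive (≡.sym eq))))) ap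
  ...   | R , contacts≡ = R ,
    ℕ.≤-trans (ℕ.+-monoʳ-≤ (2 ℕ.* length bs) k≤) (ℕ.≤-trans le (ℕ.≤-reflexive (≡.sym contacts≡)))

  lower-bound-2n∸3 : ∀ n → 2 ℕ.≤ n → (B : BoxSet n) → (2 ℕ.* n ℕ.∸ 3) ≤MaxContacts B
  lower-bound-2n∸3 (suc (suc n)) (ℕ.s≤s (ℕ.s≤s _)) B =
    ≡.subst (_≤MaxContacts B) eq (from-stack (stack (b zero) (b (suc zero))))
    where
    b : Fin (2 ℕ.+ n) → Box
    b = BoxSet.box B
    bs₀ bs : List Box
    bs₀ = b zero ∷ b (suc zero) ∷ []
    bs  = tabulate (λ i → b (2 Fin.↑ʳ i))
    from-stack : (∃₂ λ T D → Frontier T D [] × (map box (T ∷ D ∷ []) ≡ bs₀) × 1 ℕ.≤ touching (T ∷ D ∷ [])) →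
                 (2 ℕ.* length bs ℕ.+ 1) ≤MaxContacts B
    from-stack (_ , _ , F , boxes , one) = build B F refl (↭-reflexive boxes) one
    eq : 2 ℕ.* length bs ℕ.+ 1 ≡ 2 ℕ.* (2 ℕ.+ n) ℕ.∸ 3
    eq = ≡.trans (cong (λ k → 2 ℕ.* k ℕ.+ 1) (length-tabulate (λ i → b (2 Fin.↑ʳ i))))
           (≡.trans (ℕ.+-comm (2 ℕ.* n) 1) (cong (ℕ._∸ 3) (≡.sym (ℕ.*-distribˡ-+ 2 2 n))))

  lower-bound-2n∸2 : ∀ n → 5 ℕ.≤ n → (B : BoxSet n) → (2 ℕ.* n ℕ.∸ 2) ≤MaxContacts B
  lower-bound-2n∸2 (suc (suc (suc (suc (suc n))))) (ℕ.s≤s (ℕ.s≤s (ℕ.s≤s (ℕ.s≤s (ℕ.s≤s _))))) B =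
    ≡.subst (_≤MaxContacts B) eq (from-core (core bs₀ refl dist))
    where
    b : Fin (5 ℕ.+ n) → Box
    b = BoxSet.box B
    bs₀ bs : List Box
    bs₀ = tabulate {n = 5} (λ i → b (i Fin.↑ˡ n))
    bs  = tabulate (λ i → b (5 Fin.↑ʳ i))
    dist : AllPairs Distinct bs₀
    dist = AllPairs.tabulate⁺ {f = λ i → b (i Fin.↑ˡ n)} (λ i≢j → BoxSet.distinct B (i≢j ∘ Fin.↑ˡ-injective n _ _))
    from-core : Core bs₀ → (2 ℕ.* length bs ℕ.+ 8) ≤MaxContacts B
    from-core (_ , _ , _ , F , σ , eight) = build B F refl σ eight
    eq : 2 ℕ.* length bs ℕ.+ 8 ≡ 2 ℕ.* (5 ℕ.+ n) ℕ.∸ 2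
    eq = ≡.trans (cong (λ k → 2 ℕ.* k ℕ.+ 8) (length-tabulate (λ i → b (5 Fin.↑ʳ i))))
           (≡.trans (ℕ.+-comm (2 ℕ.* n) 8) (cong (ℕ._∸ 2) (≡.sym (ℕ.*-distribˡ-+ 2 5 n))))

-- Powers of three and distances below them.

module Powers {c ℓ₁ ℓ₂} (ℝ : RealNumbers c ℓ₁ ℓ₂) where

  open RealNumbers ℝ
  open OrderedField ℝ

  -- Tripling is written as a sum because this is the shape of the bound in `near-bridge`.
  3^ : ℕ → Carrier
  3^ zero    = 1#
  3^ (suc k) = 3^ k + (3^ k + 3^ k)

  0<3^ : ∀ k → 0# < 3^ k
  3^-< : ∀ k → 3^ k < 3^ (suc k)
  0<3^ zero    = 0<1
  0<3^ (suc k) = Order.trans (0<3^ k) (3^-< k)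
  3^-< k = x<x+y (3^ k) (Order.trans (0<3^ k) (x<x+y (3^ k) (0<3^ k)))

  3^-mono-< : ∀ {j k} → j ℕ.< k → 3^ j < 3^ k
  3^-mono-< {j} {suc k} (ℕ.s≤s j≤k) with ℕ.m≤n⇒m<n∨m≡n j≤k
  ... | inj₁ j<k  = Order.trans (3^-mono-< j<k) (3^-< k)
  ... | inj₂ refl = 3^-< k

  3^-injective : ∀ {j k} → 3^ j ≈ 3^ k → j ≡ k
  3^-injective {j} {k} eq with ℕ.<-cmp j k
  ... | tri< lt _ _  = ⊥-elim (Order.irrefl eq (3^-mono-< lt))
  ... | tri≈ _ j≡k _ = j≡k
  ... | tri> _ _ gt  = ⊥-elim (Order.irrefl (Ring.sym eq) (3^-mono-< gt))

  -- The condition |u - v| < d, free of absolute values.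
  Near : Carrier → Rel Carrier _
  Near d u v = u < v + d × v < u + d

  near-sym : ∀ {d} → Symmetric (Near d)
  near-sym (p , q) = q , p

  near-weaken : ∀ {d d′ u v} → d < d′ → Near d u v → Near d′ u v
  near-weaken {u = u} {v} lt (p , q) = Order.trans p (+-monoʳ-< v lt) , Order.trans q (+-monoʳ-< u lt)

  -- The way from `u` over `u′` and `v′` to `v` has two parts shorter than `d` and one of length
  -- exactly `d`. This is where the ratio 3 of consecutive sides comes from.
  near-bridge : ∀ {d u v u′ v′} → 0# < d → v′ ≈ u′ + d → Near d u u′ → Near d v v′ → Near (d + (d + d)) u v
  near-bridge {d} {u} {v} {u′} {v′} 0<d v′≈ (u<u′ , u′<u) (v<v′ , v′<v) = u<v , v<u
    where
    open Reasoning
    u<v : u < v + (d + (d + d))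
    u<v = begin-strict
      u                 <⟨ u<u′ ⟩
      u′ + d            ≈⟨ v′≈ ⟨
      v′                <⟨ v′<v ⟩
      v + d             <⟨ +-monoʳ-< v (x<x+y d (Order.trans 0<d (x<x+y d 0<d))) ⟩
      v + (d + (d + d)) ∎
    v<u : v < u + (d + (d + d))
    v<u = begin-strict
      v                 <⟨ v<v′ ⟩
      v′ + d            ≈⟨ Ring.+-congʳ v′≈ ⟩
      u′ + d + d        ≈⟨ Ring.+-assoc u′ d d ⟩
      u′ + (d + d)      <⟨ +-monoˡ-< (d + d) u′<u ⟩
      u + d + (d + d)   ≈⟨ Ring.+-assoc u d (d + d) ⟩
      u + (d + (d + d)) ∎

-- The upper bound 2n - 2 for squares of sides 1, 3, 9, ....

module UpperBound {c ℓ₁ ℓ₂} (ℝ : RealNumbers c ℓ₁ ℓ₂) where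

  open RealNumbers ℝ
  open Powers ℝ
  open Geometry ℝ

  -- One direction of contact at a time: `l` and `r` are coordinates across the lines, `b` and `t`
  -- along them. Exchanging the axes gives the other direction.
  module Line {n : ℕ} (l r b t : Fin n → Carrier)
    (r≈ : ∀ i → r i ≈ l i + 3^ (toℕ i))
    (disjoint : ∀ {i j} → i ≢ j → l i < r j → l j < r i → b i < t j → ¬ b j < t i)
    where

    l<r : ∀ i → l i < r i
    l<r i = <-≈-trans (x<x+y (l i) (0<3^ (toℕ i))) (Ring.sym (r≈ i))

    Meets : Rel (Fin n) _
    Meets i j = r i ≈ l j × b i < t j × b j < t i

    meets? : ∀ i j → Dec (Meets i j)
    meets? i j = (r i Order.≟ l j) ×-dec (b i Order.<? t j) ×-dec (b j Order.<? t i)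

    -- `inj₁ i` stands for the left side of box `i`, `inj₂ i` for its right side.
    Side : Set
    Side = Fin n ⊎ Fin n

    _≟_ : DecidableEquality Side
    _≟_ = Sum.≡-dec Fin._≟_ Fin._≟_

    position : Side → Carrier
    position = [ l , r ]

    Charged : Side → Set _
    Charged (inj₁ j) = ∃[ i ] Meets i j × t j ≤ t i
    Charged (inj₂ i) = ∃[ j ] Meets i j × t i < t j

    charged? : Unary.Decidable Charged
    charged? (inj₁ j) = Fin.any? λ i → meets? i j ×-dec (t j ≤? t i)
    charged? (inj₂ i) = Fin.any? λ j → meets? i j ×-dec (t i Order.<? t j)

    charge : Fin n → Fin n → Side
    charge i j with t i Order.<? t j
    ... | yes _ = inj₂ i
    ... | no _  = inj₁ j

    charge-charged : ∀ {i j} → Meets i j → Charged (charge i j)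
    charge-charged {i} {j} m with t i Order.<? t j
    ... | yes lt = j , m , lt
    ... | no ≮   = i , m , ≮⇒≥ ≮

    -- Two neighbours charging the same side lie on the same side of its line. Both start below its
    -- top and reach at least up to it, so two different ones would overlap just below that top.
    charge-injective : ∀ {i j i′ j′} → Meets i j → Meets i′ j′ → charge i j ≡ charge i′ j′ → i ≡ i′ × j ≡ j′
    charge-injective {i} {j} {i′} {j′} (eq , lt , gt) (eq′ , lt′ , gt′) ch
      with t i Order.<? t j | t i′ Order.<? t j′
    charge-injective {i} {j} {.i} {j′} (eq , lt , gt) (eq′ , lt′ , gt′) refl | yes ti<tj | yes ti<tj′
      with j Fin.≟ j′
    ... | yes j≡j′ = refl , j≡j′
    ... | no j≢j′  = ⊥-elim (disjoint j≢j′
      (≈-<-trans (Ring.trans (Ring.sym eq) eq′) (l<r j′)) (≈-<-trans (Ring.trans (Ring.sym eq′) eq) (l<r j))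
      (Order.trans gt ti<tj′) (Order.trans gt′ ti<tj))
    charge-injective {i} {j} {i′} {.j} (eq , lt , gt) (eq′ , lt′ , gt′) refl | no ≮ | no ≮′
      with i Fin.≟ i′
    ... | yes i≡i′ = i≡i′ , refl
    ... | no i≢i′  = ⊥-elim (disjoint i≢i′
      (<-≈-trans (l<r i) (Ring.trans eq (Ring.sym eq′))) (<-≈-trans (l<r i′) (Ring.trans eq′ (Ring.sym eq)))
      (<-≤-trans lt (≮⇒≥ ≮′)) (<-≤-trans lt′ (≮⇒≥ ≮)))

    allSides : List Side
    allSides = map inj₁ (allFin n) ++ map inj₂ (allFin n)

    ∈-allSides : ∀ s → s ∈ allSides
    ∈-allSides (inj₁ i) = ∈-++⁺ˡ (∈-map⁺ inj₁ (∈-allFin i))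
    ∈-allSides (inj₂ i) = ∈-++⁺ʳ (map inj₁ (allFin n)) (∈-map⁺ inj₂ (∈-allFin i))

    length-allSides : length allSides ≡ n ℕ.+ n
    length-allSides = ≡.trans (length-++ (map inj₁ (allFin n)))
      (cong₂ ℕ._+_ (≡.trans (length-map inj₁ (allFin n)) (length-tabulate {n = n} id))
                   (≡.trans (length-map inj₂ (allFin n)) (length-tabulate {n = n} id)))

    contact? : ∀ i j → Dec (Meets i j ⊎ Meets j i)
    contact? i j = meets? i j ⊎-dec meets? j i

    ordered? : Unary.Decidable (λ ((i , j) : Fin n × Fin n) → i Fin.< j × (Meets i j ⊎ Meets j i))
    ordered? (i , j) = (i Fin.<? j) ×-dec contact? i j

    grid : List (Fin n × Fin n)
    grid = cartesianProduct (allFin n) (allFin n)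

    contacts-≤-charged : count ordered? grid ℕ.≤ count charged? allSides
    contacts-≤-charged = injection-length side
      (Unique.filter⁺ ordered? (Unique.cartesianProduct⁺ (Unique.allFin⁺ n) (Unique.allFin⁺ n)))
      (λ {(i , j)} ij∈ → into i j (proj₂ (proj₂ (∈-filter⁻ ordered? {xs = grid} ij∈))))
      (λ {(i , j)} {(i′ , j′)} ij∈ ij∈′ → injective i j i′ j′
        (proj₂ (∈-filter⁻ ordered? {xs = grid} ij∈)) (proj₂ (∈-filter⁻ ordered? {xs = grid} ij∈′)))
      where
      side : Fin n × Fin n → Side
      side (i , j) with meets? i j
      ... | yes _ = charge i j
      ... | no _  = charge j i

      oriented : ∀ {i j} → ¬ Meets i j → Meets i j ⊎ Meets j i → Meets j i
      oriented ¬m (inj₁ m) = contradiction m ¬m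
      oriented ¬m (inj₂ m) = m

      into : ∀ i j → Meets i j ⊎ Meets j i → side (i , j) ∈ filter charged? allSides
      into i j m with meets? i j
      ... | yes m′ = ∈-filter⁺ charged? (∈-allSides _) (charge-charged m′)
      ... | no ¬m  = ∈-filter⁺ charged? (∈-allSides _) (charge-charged (oriented ¬m m))

      injective : ∀ i j i′ j′ → i Fin.< j × (Meets i j ⊎ Meets j i) → i′ Fin.< j′ × (Meets i′ j′ ⊎ Meets j′ i′) →
                  side (i , j) ≡ side (i′ , j′) → (i , j) ≡ (i′ , j′)
      injective i j i′ j′ (lt , m) (lt′ , m′) eq with meets? i j | meets? i′ j′
      ... | yes u | yes v with refl , refl ← charge-injective u v eq = refl
      ... | no ¬u | no ¬v with refl , refl ← charge-injective (oriented ¬u m) (oriented ¬v m′) eq = refl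
      -- The same contact read in opposite orientations would order its two indices both ways.
      ... | yes u | no ¬v with refl , refl ← charge-injective u (oriented ¬v m′) eq = ⊥-elim (Fin.<-asym lt lt′)
      ... | no ¬u | yes v with refl , refl ← charge-injective (oriented ¬u m) v eq = ⊥-elim (Fin.<-asym lt lt′)

    -- Higher tops come first, and a right side precedes a left side with an equal top. This matches
    -- the tie rule of `Charged`, where the left side pays, so a `⊒`-first side on its line is never
    -- charged.
    _⊒_ : Rel Side _
    inj₁ j ⊒ inj₁ j′ = t j′ ≤ t j
    inj₂ i ⊒ inj₂ i′ = t i′ ≤ t i
    inj₂ i ⊒ inj₁ j  = t j ≤ t i
    inj₁ j ⊒ inj₂ i  = ¬ t j ≤ t i

    ⊒-trans : Transitive _⊒_
    ⊒-trans {inj₁ _} {inj₁ _} {inj₁ _} p q = ≤-trans q p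
    ⊒-trans {inj₁ _} {inj₁ _} {inj₂ _} p q = λ le → q (≤-trans p le)
    ⊒-trans {inj₁ _} {inj₂ _} {inj₁ _} p q = ≤-trans q (<⇒≤ (≰⇒> p))
    ⊒-trans {inj₁ _} {inj₂ _} {inj₂ _} p q = λ le → p (≤-trans le q)
    ⊒-trans {inj₂ _} {inj₁ _} {inj₁ _} p q = ≤-trans q p
    ⊒-trans {inj₂ _} {inj₁ _} {inj₂ _} p q = ≤-trans (<⇒≤ (≰⇒> q)) p
    ⊒-trans {inj₂ _} {inj₂ _} {inj₁ _} p q = ≤-trans q p
    ⊒-trans {inj₂ _} {inj₂ _} {inj₂ _} p q = ≤-trans q p

    ⊒-total : Total _⊒_
    ⊒-total (inj₁ i) (inj₁ j) = ≤-total (t j) (t i)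
    ⊒-total (inj₂ i) (inj₂ j) = ≤-total (t j) (t i)
    ⊒-total (inj₁ i) (inj₂ j) with t i ≤? t j
    ... | yes le = inj₂ le
    ... | no ≰   = inj₁ ≰
    ⊒-total (inj₂ i) (inj₁ j) with t j ≤? t i
    ... | yes le = inj₁ le
    ... | no ≰   = inj₂ ≰

    -- On each line the highest side, with ties going to a right side, is not charged.
    uncharged : ∀ s → ∃[ u ] ¬ Charged u × position u ≈ position s
    uncharged s with selectMin {_≼_ = _⊒_} (λ {u} {v} {w} → ⊒-trans {u} {v} {w}) ⊒-total s (filter onLine? allSides)
      where
      onLine? : Unary.Decidable (λ u → position u ≈ position s)
      onLine? u = position u Order.≟ position s
    ... | m , ms , ρ , m⊒ = m , ¬charged m m⊒′ on-m , on-m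
      where
      onLine? : Unary.Decidable (λ u → position u ≈ position s)
      onLine? u = position u Order.≟ position s

      on-m : position m ≈ position s
      on-m with ∈-resp-↭ (↭-sym ρ) (here refl)
      ... | here refl = Ring.refl
      ... | there m∈  = proj₂ (∈-filter⁻ onLine? {xs = allSides} m∈)

      m⊒′ : ∀ u → position u ≈ position s → u ≢ m → m ⊒ u
      m⊒′ u on u≢m with ∈-resp-↭ ρ (there (∈-filter⁺ onLine? (∈-allSides u) on))
      ... | here u≡m = contradiction u≡m u≢m
      ... | there u∈ = All.lookup m⊒ u∈

      ¬charged : ∀ m → (∀ u → position u ≈ position s → u ≢ m → m ⊒ u) → position m ≈ position s → ¬ Charged m
      ¬charged (inj₁ j) top on (i , (eq , _) , le) = top (inj₂ i) (Ring.trans eq on) (λ ()) le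
      ¬charged (inj₂ i) top on (j , (eq , _) , lt) = ≤⇒≯ (top (inj₁ j) (Ring.trans (Ring.sym eq) on) (λ ())) lt

    free : List Side
    free = filter (¬? ∘ charged?) allSides

    -- After the boxes 0, …, k-1 have been used to merge classes of sides, each
    -- class has diameter below 3^k, so box k joins two different classes.
    merge : ∀ k → k ℕ.≤ n → ∃₂ λ (us : List Side) (class : Side → Side) →
      (∀ s → class s ∈ us) × k ℕ.+ length us ℕ.≤ length free ×
      (∀ s s′ → class s ≡ class s′ → Near (3^ k) (position s) (position s′))
    -- Initially each line is one class, named by the uncharged side found on it; sides of one class
    -- then have equal positions.
    merge zero _ = free , proj₁ ∘ uncharged ,
      (λ s → ∈-filter⁺ (¬? ∘ charged?) (∈-allSides _) (proj₁ (proj₂ (uncharged s)))) ,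
      ℕ.≤-refl , near
      where
      near : ∀ s s′ → proj₁ (uncharged s) ≡ proj₁ (uncharged s′) → Near 1# (position s) (position s′)
      near s s′ eq = ≈-<-trans same (x<x+y _ 0<1) , ≈-<-trans (Ring.sym same) (x<x+y _ 0<1)
        where
        same : position s ≈ position s′
        same = Ring.trans (Ring.sym (proj₂ (proj₂ (uncharged s))))
                 (≡.subst (λ u → position u ≈ position s′) (≡.sym eq) (proj₂ (proj₂ (uncharged s′))))
    merge (suc k) k<n with merge k (ℕ.<⇒≤ k<n)
    ... | us , class , class∈ , len , near =
      filter ≢u? us , class′ , class′∈ , len′ , near′
      where
      i : Fin n
      i = fromℕ< k<n
      u v : Side
      u = class (inj₁ i)
      v = class (inj₂ i)

      ri≈ : r i ≈ l i + 3^ k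
      ri≈ = ≡.subst (λ m → r i ≈ l i + 3^ m) (Fin.toℕ-fromℕ< k<n) (r≈ i)

      u≢v : u ≢ v
      u≢v u≡v = Order.irrefl ri≈ (proj₂ (near (inj₁ i) (inj₂ i) u≡v))

      ≢u? : Unary.Decidable (_≢ u)
      ≢u? s = ¬? (s ≟ u)

      -- The class `u` is absorbed into `v`, so the name `u` is free to be deleted, which pays for
      -- the increase of `k` in the invariant.
      class′ : Side → Side
      class′ s with class s ≟ u
      ... | yes _ = v
      ... | no _  = class s

      class′∈ : ∀ s → class′ s ∈ filter ≢u? us
      class′∈ s with class s ≟ u
      ... | yes _ = ∈-filter⁺ ≢u? (class∈ (inj₂ i)) (u≢v ∘ ≡.sym)
      ... | no ≢u = ∈-filter⁺ ≢u? (class∈ s) ≢u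

      len′ : suc k ℕ.+ length (filter ≢u? us) ℕ.≤ length free
      len′ = begin
        suc (k ℕ.+ length (filter ≢u? us)) ≡⟨ ℕ.+-suc k _ ⟨
        k ℕ.+ suc (length (filter ≢u? us)) ≤⟨ ℕ.+-monoʳ-≤ k fewer ⟩
        k ℕ.+ length us                    ≤⟨ len ⟩
        length free                        ∎
        where
        open ℕ.≤-Reasoning
        fewer : length (filter ≢u? us) ℕ.< length us
        fewer = filter-notAll ≢u? us (lose (class∈ (inj₁ i)) (λ ≢u → ≢u refl))

      near′ : ∀ s s′ → class′ s ≡ class′ s′ → Near (3^ (suc k)) (position s) (position s′)
      near′ s s′ eq with class s ≟ u | class s′ ≟ u
      ... | yes p | yes q = near-weaken (3^-< k) (near s s′ (≡.trans p (≡.sym q)))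
      ... | no _  | no _  = near-weaken (3^-< k) (near s s′ eq)
      ... | yes p | no _  = near-bridge (0<3^ k) ri≈ (near s (inj₁ i) p) (near s′ (inj₂ i) (≡.sym eq))
      ... | no _  | yes q = near-sym (near-bridge (0<3^ k) ri≈ (near s′ (inj₁ i) q) (near s (inj₂ i) eq))

    -- After all `n` merges some class is left, so at least `n + 1` sides are free. Charged and free
    -- sides together number `2n`. The argument `i` witnesses that there is a box at all.
    contacts-< : Fin n → count ordered? grid ℕ.< n
    contacts-< i = ℕ.+-cancelʳ-≤ n _ _ (begin
      suc (count ordered? grid) ℕ.+ n           ≡⟨ ℕ.+-suc (count ordered? grid) n ⟨
      count ordered? grid ℕ.+ suc n             ≤⟨ ℕ.+-mono-≤ contacts-≤-charged n<free ⟩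
      count charged? allSides ℕ.+ length free      ≡⟨ count-∁ charged? allSides ⟩
      length allSides                              ≡⟨ length-allSides ⟩
      n ℕ.+ n                                   ∎)
      where
      open ℕ.≤-Reasoning
      nonempty : ∀ {us : List Side} {s} → s ∈ us → 1 ℕ.≤ length us
      nonempty (here _)  = ℕ.s≤s ℕ.z≤n
      nonempty (there _) = ℕ.s≤s ℕ.z≤n
      n<free : suc n ℕ.≤ length free
      n<free with merge n ℕ.≤-refl
      ... | us , class , class∈ , len , _ =
        ℕ.≤-trans (≡.subst (ℕ._≤ n ℕ.+ length us) (ℕ.+-comm n 1) (ℕ.+-monoʳ-≤ n (nonempty (class∈ (inj₁ i))))) len

  squares : ∀ n → BoxSet n
  squares n = record
    { box      = λ i → record
        { width = 3^ (toℕ i) ; height = 3^ (toℕ i) ; 0<width = 0<3^ (toℕ i) ; 0<height = 0<3^ (toℕ i) }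
    ; distinct = λ i≢j (eq , _) → i≢j (Fin.toℕ-injective (3^-injective eq))
    }

  module _ {n} {B : BoxSet n} (R : Representation B) where

    open Representation R using (placed; disjoint)

    placed-apart : ∀ {i j} → i ≢ j → Apart (placed i) (placed j)
    placed-apart {i} {j} i≢j = disjoint⇒apart (placed i) (placed j) (disjoint i≢j)

  contacts-∪ : ∀ {n q r} {B : BoxSet n} (R : Representation B)
    {Q : Pred (Fin n × Fin n) q} {S : Pred (Fin n × Fin n) r} (Q? : Unary.Decidable Q) (S? : Unary.Decidable S) →
    (∀ i j → i Fin.< j → Touch (Representation.placed R i) (Representation.placed R j) → Q (i , j) ⊎ S (i , j)) →
    let grid = cartesianProduct (allFin n) (allFin n) in contacts R ℕ.≤ count Q? grid ℕ.+ count S? grid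
  contacts-∪ {n} R Q? S? split =
    length-filter-∪ (λ (i , j) → (i Fin.<? j) ×-dec touch? (placed i) (placed j)) Q? S?
      (λ {(i , j)} (lt , touch) → split i j lt touch) (cartesianProduct (allFin n) (allFin n))
    where open Representation R

  -- Every contact is counted by `X` or by `Y`, the same line argument with the axes exchanged, and
  -- each of them contributes at most one less than the number of boxes.
  squares-contacts : ∀ n → 1 ℕ.≤ n → (R : Representation (squares n)) → contacts R ℕ.≤ 2 ℕ.* n ℕ.∸ 2
  squares-contacts (suc n) _ R = begin
    contacts R
      ≤⟨ contacts-∪ R X.ordered? Y.ordered? split ⟩
    count X.ordered? X.grid ℕ.+ count Y.ordered? Y.grid
      ≤⟨ ℕ.+-mono-≤ (ℕ.s≤s⁻¹ (X.contacts-< zero)) (ℕ.s≤s⁻¹ (Y.contacts-< zero)) ⟩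
    n ℕ.+ n
      ≡⟨ cong (n ℕ.+_) (ℕ.+-identityʳ n) ⟨
    2 ℕ.* n
      ≡⟨ cong (ℕ._∸ 2) (ℕ.*-suc 2 n) ⟨
    2 ℕ.* suc n ℕ.∸ 2 ∎
    where
    open ℕ.≤-Reasoning
    open Representation R using (placed)
    r≈ : ∀ i → right (placed i) ≈ x (placed i) + 3^ (toℕ i)
    r≈ _ = Ring.refl
    t≈ : ∀ i → top (placed i) ≈ y (placed i) + 3^ (toℕ i)
    t≈ _ = Ring.refl
    disjoint : ∀ {i j} → i ≢ j → x (placed i) < right (placed j) → x (placed j) < right (placed i) →
               y (placed i) < top (placed j) → ¬ y (placed j) < top (placed i)
    disjoint {i} {j} i≢j = apart⇒¬overlap (placed i) (placed j) (placed-apart R i≢j)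
    disjoint′ : ∀ {i j} → i ≢ j → y (placed i) < top (placed j) → y (placed j) < top (placed i) →
                x (placed i) < right (placed j) → ¬ x (placed j) < right (placed i)
    disjoint′ i≢j p q u v = disjoint i≢j u v p q
    module X = Line (x ∘ placed) (right ∘ placed) (y ∘ placed) (top ∘ placed) r≈ disjoint
    module Y = Line (y ∘ placed) (top ∘ placed) (x ∘ placed) (right ∘ placed) t≈ disjoint′
    split : ∀ i j → i Fin.< j → Touch (placed i) (placed j) →
      (i Fin.< j × (X.Meets i j ⊎ X.Meets j i)) ⊎ (i Fin.< j × (Y.Meets i j ⊎ Y.Meets j i))
    split i j lt touch = Sum.map (lt ,_) (lt ,_)
      (touch⇒adjacent (placed i) (placed j) (placed-apart R (Fin.<⇒≢ lt)) touch)

  -- Four boxes cannot touch pairwise.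

  greatest : ∀ {n} (f : Fin (suc n) → Carrier) → ∃[ m ] ∀ i → f i ≤ f m
  greatest f with selectMin {_≼_ = λ i j → f j ≤ f i} (λ u v → ≤-trans v u) (λ i j → ≤-total (f j) (f i))
                    zero (tabulate suc)
  ... | m , ms , ρ , m≥ = m , λ i → bound (∈-resp-↭ ρ (∈-allFin i))
    where
    bound : ∀ {i} → i ∈ m ∷ ms → f i ≤ f m
    bound (here refl) = ≤-refl
    bound (there i∈)  = All.lookup m≥ i∈

  module AroundPoint (p : Fin 4 → PlacedBox) (adjacent : ∀ {i j} → i ≢ j → Adjacent (p i) (p j))
    (px py : Carrier)
    (x≤px : ∀ i → x (p i) ≤ px) (px≤right : ∀ i → px ≤ right (p i))
    (y≤py : ∀ i → y (p i) ≤ py) (py≤top : ∀ i → py ≤ top (p i)) where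

    -- For an interval that contains `u` and ends at `v`: `true` if it reaches past `u`, `false` if
    -- it stops there. An interval with `u` in its interior thus counts as `true`.
    Half : Bool → Carrier → Carrier → Set (ℓ₁ ⊔ ℓ₂)
    Half true  u v = ¬ v ≤ u
    Half false u v = v ≤ u

    half? : ∀ u v → ∃[ b ] Half b u v
    half? u v with v ≤? u
    ... | yes v≤u = false , v≤u
    ... | no v≰u  = true , v≰u

    -- Two intervals in the same half overlap next to `u`, just after it for `true` and just before
    -- it for `false`. With this in both coordinates, two boxes in one quadrant would overlap.
    half-overlap : ∀ b {s t u t′} → s ≤ u → s < t → u ≤ t′ → Half b u t → Half b u t′ → s < t′
    half-overlap true  s≤u s<t u≤t′ _   t′≰u = ≤-<-trans s≤u (≰⇒> t′≰u)
    half-overlap false s≤u s<t u≤t′ t≤u _    = <-≤-trans s<t (≤-trans t≤u u≤t′)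

    quadrant : Fin 4 → Bool × Bool
    quadrant i = proj₁ (half? px (right (p i))) , proj₁ (half? py (top (p i)))

    InQuadrant : Bool × Bool → Fin 4 → Set _
    InQuadrant (b , b′) i = Half b px (right (p i)) × Half b′ py (top (p i))

    inQuadrant : ∀ i → InQuadrant (quadrant i) i
    inQuadrant i = proj₂ (half? px (right (p i))) , proj₂ (half? py (top (p i)))

    apart : ∀ {i j} → i ≢ j → Apart (p i) (p j)
    apart {i} {j} i≢j = adjacent⇒apart (p i) (p j) (adjacent i≢j)

    quadrant-injective : ∀ {i j} → quadrant i ≡ quadrant j → i ≡ j
    quadrant-injective {i} {j} eq
      with i Fin.≟ j | inQuadrant i | ≡.subst (λ q → InQuadrant q j) (≡.sym eq) (inQuadrant j)
    ... | yes i≡j | _         | _           = i≡j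
    ... | no i≢j  | (hi , vi) | (hj , vj) = ⊥-elim (apart⇒¬overlap (p i) (p j) (apart i≢j)
      (half-overlap _ (x≤px i) (x<right (p i)) (px≤right j) hi hj)
      (half-overlap _ (x≤px j) (x<right (p j)) (px≤right i) hj hi)
      (half-overlap _ (y≤py i) (y<top (p i)) (py≤top j) vi vj)
      (half-overlap _ (y≤py j) (y<top (p j)) (py≤top i) vj vi))

    quadrant-surjective : ∀ q → ∃[ i ] quadrant i ≡ q
    quadrant-surjective = injective⇒surjective quadrant quadrant-injective
      (Product.≡-dec Bool._≟_ Bool._≟_) (cartesianProduct bools bools) ℕ.≤-refl
      (λ (b , b′) → ∈-cartesianProduct⁺ (∈-bools b) (∈-bools b′))
      where
      bools : List Bool
      bools = true ∷ false ∷ []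
      ∈-bools : ∀ b → b ∈ bools
      ∈-bools true  = here refl
      ∈-bools false = there (here refl)

    -- The boxes in opposite quadrants can only touch if one of them reaches into a third quadrant.
    impossible : ⊥
    impossible
      with quadrant-surjective (true , true) | quadrant-surjective (false , false)
         | quadrant-surjective (true , false) | quadrant-surjective (false , true)
    ... | a , qa | c , qc | g , qg | e , qe = clash (adjacent a≢c)
      where
      in-a = ≡.subst (λ q → InQuadrant q a) qa (inQuadrant a)
      in-c = ≡.subst (λ q → InQuadrant q c) qc (inQuadrant c)
      in-g = ≡.subst (λ q → InQuadrant q g) qg (inQuadrant g)
      in-e = ≡.subst (λ q → InQuadrant q e) qe (inQuadrant e)

      differ : ∀ {i j q q′} → quadrant i ≡ q → quadrant j ≡ q′ → q ≢ q′ → i ≢ j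
      differ eq eq′ q≢q′ refl = q≢q′ (≡.trans (≡.sym eq) eq′)
      a≢c = differ qa qc (λ ())
      a≢g = differ qa qg (λ ())
      a≢e = differ qa qe (λ ())

      px<ra = ≰⇒> (proj₁ in-a)
      py<ta = ≰⇒> (proj₂ in-a)
      px<rg = ≰⇒> (proj₁ in-g)
      py<te = ≰⇒> (proj₂ in-e)

      clash : ¬ Adjacent (p a) (p c)
      clash (inj₁ (inj₁ (eq , _))) =
        Order.asym px<ra (≈-<-trans eq (<-≤-trans (x<right (p c)) (proj₁ in-c)))
      -- `a` abuts on the right side of `c` and therefore starts below `py`, where it runs into `g`.
      -- In the last clause it lies on top of `c` and runs into `e` in the same way.
      clash (inj₁ (inj₂ (_ , _ , lt))) = apart⇒¬overlap (p a) (p g) (apart a≢g)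
        (≤-<-trans (x≤px a) px<rg) (≤-<-trans (x≤px g) px<ra)
        (<-≤-trans lt (≤-trans (proj₂ in-c) (py≤top g)))
        (<-≤-trans (y<top (p g)) (≤-trans (proj₂ in-g) (<⇒≤ py<ta)))
      clash (inj₂ (inj₁ (eq , _))) =
        Order.asym py<ta (≈-<-trans eq (<-≤-trans (y<top (p c)) (proj₂ in-c)))
      clash (inj₂ (inj₂ (_ , _ , lt))) = apart⇒¬overlap (p a) (p e) (apart a≢e)
        (<-≤-trans lt (≤-trans (proj₁ in-c) (px≤right e)))
        (<-≤-trans (x<right (p e)) (≤-trans (proj₁ in-e) (<⇒≤ px<ra)))
        (≤-<-trans (y≤py a) py<te) (≤-<-trans (y≤py e) py<ta)

  module _ {n} (p : Fin n → PlacedBox) (adjacent : ∀ {i j} → i ≢ j → Adjacent (p i) (p j)) where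

    ≤-right : ∀ i j → x (p i) ≤ right (p j)
    ≤-right i j with i Fin.≟ j
    ... | yes refl = <⇒≤ (x<right (p i))
    ... | no i≢j with adjacent i≢j
    ...   | inj₁ (inj₁ (eq , _))     = ≤-trans (<⇒≤ (x<right (p i))) (≤-trans (inj₂ eq) (<⇒≤ (x<right (p j))))
    ...   | inj₁ (inj₂ (eq , _))     = inj₂ (Ring.sym eq)
    ...   | inj₂ (inj₁ (_ , lt , _)) = <⇒≤ lt
    ...   | inj₂ (inj₂ (_ , _ , lt)) = <⇒≤ lt

    ≤-top : ∀ i j → y (p i) ≤ top (p j)
    ≤-top i j with i Fin.≟ j
    ... | yes refl = <⇒≤ (y<top (p i))
    ... | no i≢j with adjacent i≢j
    ...   | inj₂ (inj₁ (eq , _))     = ≤-trans (<⇒≤ (y<top (p i))) (≤-trans (inj₂ eq) (<⇒≤ (y<top (p j))))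
    ...   | inj₂ (inj₂ (eq , _))     = inj₂ (Ring.sym eq)
    ...   | inj₁ (inj₁ (_ , lt , _)) = <⇒≤ lt
    ...   | inj₁ (inj₂ (_ , _ , lt)) = <⇒≤ lt

  -- Helly's theorem in each coordinate: the closed projections meet pairwise, so the greatest left
  -- end and the greatest bottom are the coordinates of a common point.
  ¬four-adjacent : (p : Fin 4 → PlacedBox) → ¬ (∀ {i j} → i ≢ j → Adjacent (p i) (p j))
  ¬four-adjacent p adjacent = common (greatest (x ∘ p)) (greatest (y ∘ p))
    where
    common : (∃[ m ] ∀ i → x (p i) ≤ x (p m)) → (∃[ m ] ∀ i → y (p i) ≤ y (p m)) → ⊥
    common (m , x≤) (m′ , y≤) = AroundPoint.impossible p adjacent (x (p m)) (y (p m′))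
      x≤ (≤-right p adjacent m) y≤ (≤-top p adjacent m′)

  -- Upper bounds for at most four boxes.

  contacts-≤-choose₂ : ∀ {n} {B : BoxSet n} (R : Representation B) → contacts R ℕ.≤ choose₂ n
  contacts-≤-choose₂ R =
    ≡.subst₂ (λ k m → k ℕ.≤ choose₂ m) (≡.sym (contacts≡touching R)) (length-tabulate placed)
      (touching-≤ (tabulate placed))
    where open Representation R using (placed)

  four-contacts : {B : BoxSet 4} (R : Representation B) → contacts R ℕ.≤ 5
  four-contacts R = ≡.subst (ℕ._≤ 5) (≡.sym (contacts≡touching R))
    (ℕ.s≤s⁻¹ (touching-< (tabulate placed) λ all → ¬four-adjacent placed λ {i} {j} i≢j →
      touch⇒adjacent (placed i) (placed j) (placed-apart R i≢j)
        (AllPairs-tabulate⁻ {R = Touch} (λ {u} {v} → touch-sym {u} {v}) {f = placed} all i≢j)))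
    where open Representation R using (placed)

  -- For two and three boxes the number of pairs, 1 and 3, already is 2n - 3. Four boxes have six
  -- pairs, one too many, and not all of them touch.
  small-contacts : ∀ n → 2 ℕ.≤ n → n ℕ.≤ 4 →
    {B : BoxSet n} (R : Representation B) → contacts R ℕ.≤ 2 ℕ.* n ℕ.∸ 3
  small-contacts 2 _ _ = contacts-≤-choose₂
  small-contacts 3 _ _ = contacts-≤-choose₂
  small-contacts 4 _ _ = four-contacts
  small-contacts 0 () _
  small-contacts 1 (ℕ.s≤s ()) _
  small-contacts (suc (suc (suc (suc (suc _))))) _ (ℕ.s≤s (ℕ.s≤s (ℕ.s≤s (ℕ.s≤s ()))))

-- The value of f(n) from both bounds.

open import Data.Nat using (ℕ; _≤_; _*_; _∸_)

theorem8 : ∀ {c ℓ₁ ℓ₂} (ℝ : RealNumbers c ℓ₁ ℓ₂) → let open Boxes ℝ in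
    (∀ (n : ℕ) → 2 ≤ n → n ≤ 4 → MinMaxContacts n (2 * n ∸ 3)) ×
    (∀ (n : ℕ) → 5 ≤ n → MinMaxContacts n (2 * n ∸ 2))
theorem8 ℝ =
    (λ n 2≤n n≤4 → minMax n (small-contacts n 2≤n n≤4) (lower-bound-2n∸3 n 2≤n))
  , (λ n 5≤n → minMax n (squares-contacts n (ℕ.≤-trans (ℕ.s≤s ℕ.z≤n) 5≤n)) (lower-bound-2n∸2 n 5≤n))
  where
  open Boxes ℝ
  open LowerBound ℝ
  open UpperBound ℝ
  -- The squares serve as the extremal set for small `n` as well, where the upper bound holds for
  -- all sets of boxes. The lower bound, applied to the squares, supplies the representation that
  -- attains `m`.
  minMax : ∀ n {m} → (∀ (R : Representation (squares n)) → contacts R ≤ m) →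
           (∀ (B : BoxSet n) → m ≤MaxContacts B) → MinMaxContacts n m
  minMax n upper lower = (squares n , (R , ℕ.≤-antisym (upper R) m≤) , upper) , lower
    where
    R = proj₁ (lower (squares n))
    m≤ = proj₂ (lower (squares n))
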